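{- Let $M$ be a matroid having positive rank $r$, on an $n$-element set. For any $(n,r-1)$-composition $(a_0,a_1,\ldots,a_{r-2},a'_{r-1})$, the number of flags of $\mathrm{Trun}(M)$ that have that composition, that is, $\nu(\mathrm{Trun}(M);a_0,a_1,\ldots,a_{r-2},a'_{r-1})$, is $$\sum_{\substack{a_{r-1},a_r\in\mathbb{N}\,:\\ a_{r-1}+a_r=a'_{r-1}}}\nu(M;a_0,a_1,\ldots,a_{r-2},a_{r-1},a_r)\cdot\frac{a_{r-1}}{a_{r-1}+a_r}.$$ Thus, $$\mathcal{G}(\mathrm{Trun}(M))=\sum\nu(M;a_0,a_1,\ldots,a_r)\cdot\frac{a_{r-1}}{a_{r-1}+a_r}\cdot\gamma(a_0,a_1,\ldots,a_{r-2},a_{r-1}+a_r),$$ where the sum is over all $(n,r)$-compositions $(a_0,a_1,\ldots,a_r)$.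
   Context: The truncation $\mathrm{Trun}(M)$ of a matroid $M$ of positive rank is the matroid on the same set whose bases are the independent sets of $M$ of size $r(M)-1$. $\mathbb{N}$ denotes the positive integers. An $(n,r)$-composition is an integer sequence $(a_0,a_1,\ldots,a_r)$ with $a_0\ge0$, $a_j>0$ for $1\le j\le r$, and $a_0+\cdots+a_r=n$. A flag of a rank-$r$ matroid $M$ on an $n$-set $E$ is a chain $X_0\subset X_1\subset\cdots\subset X_r=E$ of flats with $r(X_j)=j$; its composition is $(|X_0|,|X_1-X_0|,\ldots,|X_r-X_{r-1}|)$. $\nu(M;a_0,\ldots,a_r)$ is the number of flags of $M$ with composition $(a_0,\ldots,a_r)$. $\mathcal{G}(n,r)$ is the vector space over a field of characteristic zero with basis the formal symbols $[\underline{r}]$, one for each $0,1$-sequence of length $n$ with exactly $r$ ones. For a permutation (linear ordering) $\pi$ of $E$, the rank sequence $\underline{r}(\pi)=r_1\ldots r_n$ has $r_j=r(\{\pi(1),\ldots,\pi(j)\})-r(\{\pi(1),\ldots,\pi(j-1)\})$, and $\mathcal{G}(M)=\sum_\pi[\underline{r}(\pi)]\in\mathcal{G}(n,r)$ over all $n!$ permutations of $E$. Write $(b_0,\ldots,b_r)\trianglerighteq(a_0,\ldots,a_r)$ if $b_0+\cdots+b_j\le a_0+\cdots+a_j$ for all $j$, and $(t)_k=t(t-1)\cdots(t-k+1)$. For an $(n,r)$-composition $(a_0,\ldots,a_r)$, $$\gamma(a_0,\ldots,a_r)=\sum_{(b_j)\trianglerighteq(a_j)}(a_0)_{b_0}\Biggl(\prod_{j=1}^r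 a_j\Bigl(a_j-1+\sum_{i=0}^{j-1}(a_i-b_i)\Bigr)_{b_j-1}\Biggr)[0^{b_0}10^{b_1-1}\ldots10^{b_r-1}],$$ the sum over $(n,r)$-compositions $(b_0,\ldots,b_r)\trianglerighteq(a_0,\ldots,a_r)$; $0^b$ denotes a run of $b$ zeros.
   Formalization: The rank r is taken to be at least 2 rather than merely positive: for r = 1 both formulas fail for every matroid (for U_{1,1}, the number of flags of the truncation with composition (1) is 1, while the sum is 0). -}

module Defs where

open import Algebra.Apartness.Bundles using (HeytingField; HeytingCommutativeRing)
open import Algebra.Bundles using (CommutativeRing)
import Algebra.Definitions.RawMonoid as RawMonoidDefs
open import Data.Bool.Base using (if_then_else_)
import Data.Bool.Properties as Bool
open import Data.Fin.Base using (Fin; zero; suc; toℕ; inject₁)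
import Data.Fin.Properties as Fin
open import Data.Fin.Subset
open import Data.Fin.Subset.Properties
import Data.Integer.Base as ℤ
open import Data.List.Base as List using (List; []; _∷_; _++_; filter; length; upTo; allFin; concatMap)
open import Data.List.Extrema.Nat using (max)
import Data.List.Properties as List
open import Data.List.Relation.Unary.All as ListAll using ()
open import Data.Nat.Base using (ℕ; zero; suc; _+_; _*_; _∸_; _≤_; _<_; z≤n; s≤s)
open import Data.Nat.Combinatorics.Base using (_P_)
import Data.Nat.Properties as ℕ
open import Data.Product.Base using (_×_; _,_; ∃-syntax; proj₁; proj₂)
open import Data.Rational.Base as ℚ using (ℚ)
open import Data.Sum.Base using (inj₁; inj₂)
open import Data.Vec.Base as Vec using (Vec; []; _∷_; lookup; tabulate; tail)
import Data.Vec.Properties as Vec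
open import Data.Vec.Relation.Unary.All as VecAll using ()
open import Data.Vec.Relation.Unary.AllPairs as AllPairs using (AllPairs)
open import Function.Base using (_∘_)
open import Function.Bundles using (_⇔_; mk⇔)
open import Relation.Binary.Definitions as B using ()
open import Relation.Binary.PropositionalEquality using (_≡_; refl; sym; trans; cong; subst)
open import Relation.Nullary using (yes; no; does; contradiction)
open import Relation.Nullary.Decidable using (_×-dec_; _→-dec_; ¬?)
open import Relation.Unary using (Decidable)

private
  variable
    A : Set
    n r : ℕ

-- All words of length k over an alphabet; a duplicate-free alphabet gives a
-- duplicate-free list, so filtering it and taking lengths counts words.
words : List A → (k : ℕ) → List (Vec A k)
words xs zero    = [] ∷ []
words xs (suc k) = List.cartesianProductWith _∷_ xs (words xs k)

subsets : ∀ n → List (Subset n)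
subsets n = words (outside ∷ inside ∷ []) n

record Matroid (n : ℕ) : Set₁ where
  field
    Indep      : Subset n → Set
    indep?     : Decidable Indep
    empty      : Indep ⊥
    hereditary : ∀ {I J} → I ⊆ J → Indep J → Indep I
    augment    : ∀ {I J} → Indep I → Indep J → ∣ I ∣ < ∣ J ∣ →
                 ∃[ e ] (e ∈ J × e ∉ I × Indep (I ∪ ⁅ e ⁆))

  IsBasis : Subset n → Set
  IsBasis B = Indep B × (∀ {I} → Indep I → B ⊆ I → I ⊆ B)

  rk : Subset n → ℕ
  rk X = max 0 (List.map ∣_∣ (filter (λ I → (I ⊆? X) ×-dec indep? I) (subsets n)))

  rank : ℕ
  rank = rk ⊤

  IsFlat : Subset n → Set
  IsFlat F = ∀ x → x ∉ F → rk F < rk (F ∪ ⁅ x ⁆)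

  isFlat? : Decidable IsFlat
  isFlat? F = Fin.all? λ x → ¬? (x ∈? F) →-dec (rk F ℕ.<? rk (F ∪ ⁅ x ⁆))

open Matroid

∣p∪⁅x⁆∣≤1+∣p∣ : (p : Subset n) (x : Fin n) → ∣ p ∪ ⁅ x ⁆ ∣ ≤ suc ∣ p ∣
∣p∪⁅x⁆∣≤1+∣p∣ p x = ℕ.≤-trans (∪-size p ⁅ x ⁆) (ℕ.≤-reflexive (trans (cong (∣ p ∣ +_) (∣⁅x⁆∣≡1 x)) (ℕ.+-comm ∣ p ∣ 1)))
  where
  ∪-size : ∀ {m} (p q : Subset m) → ∣ p ∪ q ∣ ≤ ∣ p ∣ + ∣ q ∣
  ∪-size []            []            = z≤n
  ∪-size (outside ∷ p) (outside ∷ q) = ∪-size p q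
  ∪-size (outside ∷ p) (inside  ∷ q) = subst (suc ∣ p ∪ q ∣ ≤_) (sym (ℕ.+-suc ∣ p ∣ ∣ q ∣)) (s≤s (∪-size p q))
  ∪-size (inside  ∷ p) (outside ∷ q) = s≤s (∪-size p q)
  ∪-size (inside  ∷ p) (inside  ∷ q) = s≤s (ℕ.≤-trans (∪-size p q) (ℕ.+-monoʳ-≤ ∣ p ∣ (ℕ.n≤1+n ∣ q ∣)))

∣p∪⁅x⁆∣≡1+∣p∣ : {p : Subset n} {x : Fin n} → x ∉ p → ∣ p ∪ ⁅ x ⁆ ∣ ≡ suc ∣ p ∣
∣p∪⁅x⁆∣≡1+∣p∣ {p = p} {x} x∉p = ℕ.≤-antisym (∣p∪⁅x⁆∣≤1+∣p∣ p x)
  (p⊂q⇒∣p∣<∣q∣ (p⊆p∪q ⁅ x ⁆ , x , q⊆p∪q p ⁅ x ⁆ (x∈⁅x⁆ x) , x∉p))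

module _ (M : Matroid n) where

  rk-attained : ∀ X → ∃[ I ] (I ⊆ X × Indep M I × ∣ I ∣ ≡ rk M X)
  rk-attained X with argmax-sel (λ k → k) 0 (List.map ∣_∣ candidates)
    where
    open import Data.List.Extrema ℕ.≤-totalOrder using (argmax-sel)
    candidates : List (Subset n)
    candidates = filter (λ I → (I ⊆? X) ×-dec indep? M I) (subsets n)
  ... | inj₁ eq = ⊥ , ⊥⊆ , empty M , trans (∣⊥∣≡0 n) (sym eq)
  ... | inj₂ el with ∈-map⁻ ∣_∣ el
    where open import Data.List.Membership.Propositional.Properties using (∈-map⁻)
  ... | I , I∈ , eq with ∈-filter⁻ (λ I → (I ⊆? X) ×-dec indep? M I) {xs = subsets n} I∈
    where open import Data.List.Membership.Propositional.Properties using (∈-filter⁻)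
  ... | _ , I⊆X , ind = I , I⊆X , ind , sym eq

  extend : ∀ d {I} → Indep M I → suc (d + ∣ I ∣) ≡ rank M →
           ∃[ B ] (I ⊆ B × Indep M B × suc ∣ B ∣ ≡ rank M)
  extend zero    {I} ind eq = I , (λ x∈ → x∈) , ind , eq
  extend (suc d) {I} ind eq with rk-attained ⊤
  ... | J , _ , indJ , ∣J∣ with augment M ind indJ (subst (∣ I ∣ <_) (trans eq (sym ∣J∣)) (s≤s (ℕ.≤-trans (ℕ.m≤n+m ∣ I ∣ d) (ℕ.n≤1+n _))))
  ... | e , _ , e∉I , ind′ with extend d ind′ (trans (cong (λ m → suc (d + m)) (∣p∪⁅x⁆∣≡1+∣p∣ e∉I)) (trans (cong suc (ℕ.+-suc d ∣ I ∣)) eq))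
  ... | B , I′⊆B , indB , ∣B∣ = B , I′⊆B ∘ p⊆p∪q ⁅ e ⁆ , indB , ∣B∣

  extend′ : ∀ {I} → Indep M I → ∣ I ∣ < rank M →
            ∃[ B ] (I ⊆ B × Indep M B × suc ∣ B ∣ ≡ rank M)
  extend′ {I} ind lt = extend (rank M ∸ suc ∣ I ∣) ind
    (trans (sym (ℕ.+-suc _ ∣ I ∣)) (ℕ.m∸n+n≡m lt))

-- The independent sets are the subsets of the prescribed bases; Trun-basis
-- confirms that its bases are exactly those.
Trun : (M : Matroid n) → 0 < rank M → Matroid n
Trun {n} M pos = record
  { Indep      = λ I → ∃[ B ] (I ⊆ B × Indep M B × suc ∣ B ∣ ≡ rank M)
  ; indep?     = λ I → anySubset? λ B → (I ⊆? B) ×-dec (indep? M B ×-dec (suc ∣ B ∣ ℕ.≟ rank M))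
  ; empty      = extend′ M (empty M) (subst (_< rank M) (sym (∣⊥∣≡0 n)) pos)
  ; hereditary = λ I⊆J (B , J⊆B , rest) → B , J⊆B ∘ I⊆J , rest
  ; augment    = aug
  }
  where
  aug : ∀ {I J} → (∃[ B ] (I ⊆ B × Indep M B × suc ∣ B ∣ ≡ rank M)) →
                  (∃[ B ] (J ⊆ B × Indep M B × suc ∣ B ∣ ≡ rank M)) → ∣ I ∣ < ∣ J ∣ →
        ∃[ e ] (e ∈ J × e ∉ I × ∃[ B ] (I ∪ ⁅ e ⁆ ⊆ B × Indep M B × suc ∣ B ∣ ≡ rank M))
  aug {I} {J} (B , I⊆B , indB , _) (C , J⊆C , indC , ∣C∣) lt
    with augment M (hereditary M I⊆B indB) (hereditary M J⊆C indC) lt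
  ... | e , e∈J , e∉I , ind = e , e∈J , e∉I , extend′ M ind
    (subst (suc ∣ I ∪ ⁅ e ⁆ ∣ ≤_) ∣C∣
      (s≤s (ℕ.≤-trans (∣p∪⁅x⁆∣≤1+∣p∣ I e) (ℕ.≤-trans lt (p⊆q⇒∣p∣≤∣q∣ J⊆C)))))

Trun-basis : (M : Matroid n) (pos : 0 < rank M) {B : Subset n} →
             IsBasis (Trun M pos) B ⇔ (Indep M B × suc ∣ B ∣ ≡ rank M)
Trun-basis M pos {B} = mk⇔ to from
  where
  to : IsBasis (Trun M pos) B → Indep M B × suc ∣ B ∣ ≡ rank M
  to ((C , B⊆C , indC , ∣C∣) , maximal)
    with ⊆-antisym B⊆C (maximal (C , (λ x∈ → x∈) , indC , ∣C∣) B⊆C)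
  ... | refl = indC , ∣C∣

  from : Indep M B × suc ∣ B ∣ ≡ rank M → IsBasis (Trun M pos) B
  from (indB , ∣B∣) = (B , (λ x∈ → x∈) , indB , ∣B∣) , maximal
    where
    maximal : ∀ {I} → ∃[ C ] (I ⊆ C × Indep M C × suc ∣ C ∣ ≡ rank M) → B ⊆ I → I ⊆ B
    maximal (C , I⊆C , _ , ∣C∣) B⊆I {x} x∈I with x ∈? B
    ... | yes x∈B = x∈B
    ... | no  x∉B = contradiction (ℕ.suc-injective (trans ∣B∣ (sym ∣C∣)))
                      (ℕ.<⇒≢ (p⊂q⇒∣p∣<∣q∣ (I⊆C ∘ B⊆I , x , I⊆C x∈I , x∉B)))

-- An (n , r)-composition has r + 1 parts a₀ , … , aᵣ.
IsComposition : ∀ n r → Vec ℕ (suc r) → Set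
IsComposition n r a = VecAll.All (0 <_) (tail a) × Vec.sum a ≡ n

isComposition? : ∀ n r → Decidable (IsComposition n r)
isComposition? n r a = VecAll.all? (0 ℕ.<?_) (tail a) ×-dec (Vec.sum a ℕ.≟ n)

compositions : ∀ n r → List (Vec ℕ (suc r))
compositions n r = filter (isComposition? n r) (words (upTo (suc n)) (suc r))

-- The last two conditions force r to be the rank of M.
IsFlag : Matroid n → Vec (Subset n) (suc r) → Set
IsFlag {r = r} M X =
    (∀ (j : Fin r) → lookup X (inject₁ j) ⊂ lookup X (suc j))
  × (∀ j → IsFlat M (lookup X j))
  × (∀ j → rk M (lookup X j) ≡ toℕ j)
  × Vec.last X ≡ ⊤

isFlag? : (M : Matroid n) → Decidable (IsFlag {r = r} M)
isFlag? M X =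
        Fin.all? (λ j → lookup X (inject₁ j) ⊂? lookup X (suc j))
  ×-dec Fin.all? (λ j → isFlat? M (lookup X j))
  ×-dec Fin.all? (λ j → rk M (lookup X j) ℕ.≟ toℕ j)
  ×-dec Vec.≡-dec Bool._≟_ (Vec.last X) ⊤

flagComposition : Vec (Subset n) (suc r) → Vec ℕ (suc r)
flagComposition X =
  ∣ lookup X zero ∣ ∷ tabulate (λ j → ∣ lookup X (suc j) ─ lookup X (inject₁ j) ∣)

ν : Matroid n → Vec ℕ (suc r) → ℕ
ν {n} {r} M a = length (filter
  (λ X → isFlag? M X ×-dec Vec.≡-dec ℕ._≟_ (flagComposition X) a)
  (words (subsets n) (suc r)))

prefix : ∀ {m} → Vec ℕ m → ℕ → ℕ
prefix _       zero    = 0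
prefix []      (suc k) = 0
prefix (x ∷ a) (suc k) = x + prefix a k

_⊵_ : Vec ℕ (suc r) → Vec ℕ (suc r) → Set
_⊵_ {r} b a = ∀ (j : Fin (suc r)) → prefix b (suc (toℕ j)) ≤ prefix a (suc (toℕ j))

_⊵?_ : B.Decidable (_⊵_ {r})
b ⊵? a = Fin.all? λ j → prefix b (suc (toℕ j)) ℕ.≤? prefix a (suc (toℕ j))

-- γ-factor a b j is the factor with index j + 1 in the definition of γ, whose
-- inner sum is a difference of prefixes; the falling factorial (t)ₖ is t P k.  For compositions b ⊵ a every truncated
-- subtraction below is an honest one: aⱼ , bⱼ ≥ 1 for j ≥ 1, and prefix sums of
-- b are bounded by those of a.
γ-factor : Vec ℕ (suc r) → Vec ℕ (suc r) → Fin r → ℕ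
γ-factor a b j = lookup a (suc j) *
  ((lookup a (suc j) ∸ 1 + (prefix a (suc (toℕ j)) ∸ prefix b (suc (toℕ j))))
    P (lookup b (suc j) ∸ 1))

γ-coeff : Vec ℕ (suc r) → Vec ℕ (suc r) → ℕ
γ-coeff {r} a b =
  (lookup a zero P lookup b zero) * List.product (List.map (γ-factor a b) (allFin r))

-- 0^{b₀} 1 0^{b₁-1} … 1 0^{bᵣ-1}
word : Vec ℕ (suc r) → List ℕ
word (b₀ ∷ bs) = List.replicate b₀ 0
              ++ concatMap (λ b → 1 ∷ List.replicate (b ∸ 1) 0) (Vec.toList bs)

orderings : ∀ n → List (Vec (Fin n) n)
orderings n = filter (AllPairs.allPairs? λ x y → ¬? (x Fin.≟ y)) (words (allFin n) n)

increments : ∀ {m} → Matroid n → Subset n → Vec (Fin n) m → List ℕ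
increments M X []      = []
increments M X (x ∷ π) = (rk M (X ∪ ⁅ x ⁆) ∸ rk M X) ∷ increments M (X ∪ ⁅ x ⁆) π

rankSequence : Matroid n → Vec (Fin n) n → List ℕ
rankSequence M = increments M ⊥

record Symbol (n r : ℕ) : Set where
  field
    entries : List ℕ
    binary  : ListAll.All (_≤ 1) entries
    size    : length entries ≡ n
    ones    : List.sum entries ≡ r

ℕ→ℚ : ℕ → ℚ
ℕ→ℚ m = ℤ.+ m ℚ./ 1

-- a / b, with the value 0 when b = 0; only positive b matter.
ratio : ℕ → ℕ → ℚ
ratio a zero      = ℚ.0ℚ
ratio a b@(suc _) = ℤ.+ a ℚ./ b

sumℚ : List A → (A → ℚ) → ℚ
sumℚ xs f = List.foldr ℚ._+_ ℚ.0ℚ (List.map f xs)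

splittings : ℕ → List (ℕ × ℕ)
splittings s =
  filter (λ p → (0 ℕ.<? proj₁ p) ×-dec (0 ℕ.<? proj₂ p) ×-dec (proj₁ p + proj₂ p ℕ.≟ s))
         (List.cartesianProduct (upTo (suc s)) (upTo (suc s)))

module 𝒢-Space {c ℓ₁ ℓ₂} (K : HeytingField c ℓ₁ ℓ₂) where
  private
    module K = HeytingField K
    commutativeRing : CommutativeRing c ℓ₁
    commutativeRing = HeytingCommutativeRing.commutativeRing K.heytingCommutativeRing

  open RawMonoidDefs (CommutativeRing.+-rawMonoid commutativeRing) public
    using () renaming (_×_ to _×ᴷ_)

  fromℕ : ℕ → K.Carrier
  fromℕ m = m ×ᴷ K.1#

  -- In a Heyting field, x # 0 says that x is invertible.
  CharacteristicZero : Set ℓ₂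
  CharacteristicZero = ∀ m → fromℕ (suc m) K.# K.0#

  -- a / b, with the value 0 when b = 0; only positive b matter.
  -- #⇒invertible inverts b − 0.
  ratioᴷ : CharacteristicZero → ℕ → ℕ → K.Carrier
  ratioᴷ char0 a zero    = K.0#
  ratioᴷ char0 a (suc b) = fromℕ a K.* proj₁ (K.#⇒invertible (char0 b))

  -- Vectors of 𝒢(n,r) are given by their coordinates in the basis of symbols.
  𝒢 : ℕ → ℕ → Set c
  𝒢 n r = Symbol n r → K.Carrier

  infix  4 _≋_
  infixr 7 _·_

  _≋_ : 𝒢 n r → 𝒢 n r → Set ℓ₁
  u ≋ v = ∀ s → u s K.≈ v s

  _·_ : K.Carrier → 𝒢 n r → 𝒢 n r
  (x · v) s = x K.* v s

  ∑ : List A → (A → 𝒢 n r) → 𝒢 n r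
  ∑ xs f s = List.foldr K._+_ K.0# (List.map (λ x → f x s) xs)

  -- The basis vector of the symbol with entries w.  It is only ever applied to
  -- 0,1-words of length n with r ones.
  [_] : List ℕ → 𝒢 n r
  [ w ] s = if does (List.≡-dec ℕ._≟_ w (Symbol.entries s)) then K.1# else K.0#

  -- Used with r = rank M.
  𝒢-invariant : ∀ r → Matroid n → 𝒢 n r
  𝒢-invariant {n} r M = ∑ (orderings n) λ π → [ rankSequence M π ]

  γ : Vec ℕ (suc r) → 𝒢 n r
  γ {r} {n} a = ∑ (filter (_⊵? a) (compositions n r)) λ b → fromℕ (γ-coeff a b) · [ word b ]

-- A flag of Trun M is a chain of flats X₀ ⊂ … ⊂ X_{r-2} of M followed by E, and
-- the flags of M extending this chain insert a hyperplane H ⊇ X_{r-2}.  The sets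
-- H ─ X_{r-2} partition E ─ X_{r-2}, so giving H the weight ∣H ─ X_{r-2}∣ /
-- ∣E ─ X_{r-2}∣ makes the weights over each chain add up to 1.  Hence, for every
-- function h of compositions, the weighted sum of h over the flags of M, with the
-- last two parts merged, is the sum of h over the flags of Trun M.
--
-- The first formula takes for h an indicator function.  For the second, an
-- ordering π of a matroid N determines the flag of closures of its initial
-- segments; given the flag, the orderings with rank sequence 0^{b₀}10^{b₁-1}… are
-- chosen element by element, each 1 picking an element of Xⱼ ─ Xⱼ₋₁ and each 0 an
-- unused element of the current flat.  Their number is the coefficient in γ of
-- the flag's composition, so 𝒢(N) is the sum of γ over the flags of N, and h = γ.
module Submission where

open import Defs
open import Algebra.Apartness.Bundles using (HeytingField; HeytingCommutativeRing)
open import Algebra.Bundles using (CommutativeSemiring; CommutativeRing)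
import Algebra.Properties.CommutativeSemigroup as CommutativeSemigroupProperties
import Algebra.Properties.Ring as RingProperties
import Algebra.Properties.Semiring.Mult as SemiringMult
open import Data.Bool.Base using (true; false; if_then_else_)
import Data.Bool.Properties as Bool
open import Data.Fin.Base using (Fin; zero; suc; toℕ; inject₁)
import Data.Fin.Properties as Fin
open import Data.Fin.Subset hiding (⊥)
open import Data.Fin.Subset as Subset using ()
open import Data.Fin.Subset.Properties
import Data.Integer.Base as ℤ
import Data.Integer.Properties as ℤ
open import Data.List.Base as List using (List; []; _∷_; _++_; filter; length; upTo; allFin)
import Data.Nat.Properties as ℕ
open import Data.List.Extrema ℕ.≤-totalOrder using (xs≤max)
open import Data.List.Membership.Propositional using () renaming (_∈_ to _∈ˡ_)
open import Data.List.Membership.Propositional.Properties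
  using (∈-cartesianProductWith⁺; ∈-cartesianProduct⁺; ∈-upTo⁺; ∈-filter⁺; ∈-filter⁻; ∈-map⁺)
import Data.List.Properties as List
open import Data.List.Relation.Unary.All as ListAll using ()
import Data.List.Relation.Unary.AllPairs as ListAllPairs
open import Data.List.Relation.Unary.Any using (here; there)
open import Data.List.Relation.Unary.Unique.Propositional using (Unique)
import Data.List.Relation.Unary.Unique.Propositional.Properties as Unique
open import Data.Nat.Base using (ℕ; zero; suc; _+_; _*_; _∸_; _⊓_; _≤_; _<_; _≤ᵇ_; _<ᵇ_; z≤n; s≤s)
import Data.Nat.ListAction as ListAction
open import Data.Nat.Combinatorics using (_P_)
open import Data.Nat.Combinatorics.Specification using (nP′k≡n[n∸1P′k∸1])
open import Data.Product.Base using (_×_; _,_; ∃-syntax; proj₁; proj₂)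
open import Data.Rational.Base as ℚ using ()
import Data.Rational.Properties as ℚ
import Data.Rational.Unnormalised.Base as ℚᵘ
import Data.Rational.Unnormalised.Properties as ℚᵘ
open import Data.Sum.Base using (inj₁; inj₂)
open import Data.Vec.Base as Vec using (Vec; []; _∷_; _∷ʳ_; init; last; lookup; tail)
import Data.Vec.Properties as Vec
open import Data.Vec.Relation.Unary.All as VecAll using ([]; _∷_)
open import Data.Vec.Relation.Unary.AllPairs as AllPairs using (AllPairs; []; _∷_)
open import Function.Base using (_∘_; id)
import Level
open Level using (Level)
open import Relation.Binary.PropositionalEquality.Core using (_≡_; _≢_; refl; sym; trans; cong; cong₂; subst)
open import Relation.Binary.PropositionalEquality.Properties using (module ≡-Reasoning)
open import Relation.Nullary using (Dec; yes; no; does; ¬_; contradiction)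
open import Relation.Nullary.Decidable using (_×-dec_; ¬?; dec-true)
open import Relation.Unary using (Decidable)

private
  variable
    a p q : Level
    A B C : Set a
    Φ : Set p
    Ψ : Set q
    n r k m : ℕ

-- Finite sums in a commutative semiring

module Sum {c ℓ} (R : CommutativeSemiring c ℓ) where
  private module R = CommutativeSemiring R
  open R using (Carrier; _≈_; 0#; 1#; +-cong)
  open SemiringMult R.semiring using (×-homo-+) renaming (_×_ to _×ᴿ_)
  open CommutativeSemigroupProperties R.+-commutativeSemigroup using (interchange)

  -- This unfolds to the same fold as `sumℚ` and, at each coordinate, as `∑`, so general results
  -- about it apply to both without conversion.
  sum : List A → (A → Carrier) → Carrier
  sum xs f = List.foldr R._+_ 0# (List.map f xs)

  -- Conditions are carried as decidable weights on fixed lists rather than as filtered lists, so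
  -- that sums can be swapped and conditions moved through products.
  when : Dec Φ → Carrier → Carrier
  when p? v = if does p? then v else 0#

  fromℕ : ℕ → Carrier
  fromℕ m = m ×ᴿ 1#

  when-yes : (p? : Dec Φ) {v : Carrier} → Φ → when p? v ≈ v
  when-yes (yes _) _ = R.refl
  when-yes (no ¬p) p = contradiction p ¬p

  when-no : (p? : Dec Φ) {v : Carrier} → ¬ Φ → when p? v ≈ 0#
  when-no (yes p) ¬p = contradiction p ¬p
  when-no (no _)  _  = R.refl

  -- The values are compared only where the condition holds; this is how facts about a flag or a
  -- cover enter under a sum.
  when-cong : (p? : Dec Φ) (q? : Dec Ψ) {v w : Carrier} →
              (Φ → Ψ) → (Ψ → Φ) → (Φ → v ≈ w) → when p? v ≈ when q? w
  when-cong (yes p) (yes _) _ _ e = e p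
  when-cong (yes p) (no ¬q) f _ _ = contradiction (f p) ¬q
  when-cong (no ¬p) (yes q) _ g _ = contradiction (g q) ¬p
  when-cong (no _)  (no _)  _ _ _ = R.refl

  when-congʳ : (p? : Dec Φ) {v w : Carrier} → (Φ → v ≈ w) → when p? v ≈ when p? w
  when-congʳ p? = when-cong p? p? id id

  when-× : (p? : Dec Φ) (q? : Dec Ψ) {v : Carrier} →
           when (p? ×-dec q?) v ≈ when p? (when q? v)
  when-× (yes _) (yes _) = R.refl
  when-× (yes _) (no _)  = R.refl
  when-× (no _)  (yes _) = R.refl
  when-× (no _)  (no _)  = R.refl

  when-0 : (p? : Dec Φ) → when p? 0# ≈ 0#
  when-0 (yes _) = R.refl
  when-0 (no _)  = R.refl

  when-*ʳ : (p? : Dec Φ) {v w : Carrier} → when p? v R.* w ≈ when p? (v R.* w)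
  when-*ʳ (yes _) = R.refl
  when-*ʳ (no _)  = R.zeroˡ _

  when-*ˡ : (p? : Dec Φ) {v w : Carrier} → v R.* when p? w ≈ when p? (v R.* w)
  when-*ˡ (yes _) = R.refl
  when-*ˡ (no _)  = R.zeroʳ _

  when-1-* : (p? : Dec Φ) {v : Carrier} → when p? 1# R.* v ≈ when p? v
  when-1-* p? = R.trans (when-*ʳ p?) (when-congʳ p? λ _ → R.*-identityˡ _)

  sum-cong : (xs : List A) {f g : A → Carrier} → (∀ x → f x ≈ g x) → sum xs f ≈ sum xs g
  sum-cong []       e = R.refl
  sum-cong (x ∷ xs) e = +-cong (e x) (sum-cong xs e)

  sum-0 : (xs : List A) {f : A → Carrier} → (∀ x → f x ≈ 0#) → sum xs f ≈ 0#
  sum-0 []       e = R.refl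
  sum-0 (x ∷ xs) e = R.trans (+-cong (e x) (sum-0 xs e)) (R.+-identityˡ 0#)

  sum-+ : (xs : List A) {f g : A → Carrier} →
          sum xs (λ x → f x R.+ g x) ≈ sum xs f R.+ sum xs g
  sum-+ []       = R.sym (R.+-identityˡ 0#)
  sum-+ (x ∷ xs) = R.trans (R.+-congˡ (sum-+ xs)) (interchange _ _ _ _)

  sum-*ˡ : (xs : List A) {u : Carrier} {f : A → Carrier} →
           sum xs (λ x → u R.* f x) ≈ u R.* sum xs f
  sum-*ˡ []       = R.sym (R.zeroʳ _)
  sum-*ˡ (x ∷ xs) = R.trans (R.+-congˡ (sum-*ˡ xs)) (R.sym (R.distribˡ _ _ _))

  sum-*ʳ : (xs : List A) {u : Carrier} {f : A → Carrier} →
           sum xs (λ x → f x R.* u) ≈ sum xs f R.* u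
  sum-*ʳ []       = R.sym (R.zeroˡ _)
  sum-*ʳ (x ∷ xs) = R.trans (R.+-congˡ (sum-*ʳ xs)) (R.sym (R.distribʳ _ _ _))

  sum-when : (xs : List A) (p? : Dec Φ) {f : A → Carrier} →
             sum xs (λ x → when p? (f x)) ≈ when p? (sum xs f)
  sum-when xs (yes _) = R.refl
  sum-when xs (no _)  = sum-0 xs λ _ → R.refl

  sum-swap : (xs : List A) (ys : List B) {f : A → B → Carrier} →
             sum xs (λ x → sum ys (f x)) ≈ sum ys (λ y → sum xs (λ x → f x y))
  sum-swap []       ys = R.sym (sum-0 ys λ _ → R.refl)
  sum-swap (x ∷ xs) ys = R.trans (R.+-congˡ (sum-swap xs ys)) (R.sym (sum-+ ys))

  sum-++ : (xs {ys} : List A) {f : A → Carrier} → sum (xs ++ ys) f ≈ sum xs f R.+ sum ys f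
  sum-++ []       = R.sym (R.+-identityˡ _)
  sum-++ (x ∷ xs) = R.trans (R.+-congˡ (sum-++ xs)) (R.sym (R.+-assoc _ _ _))

  sum-map : (xs : List A) {g : A → B} {f : B → Carrier} →
            sum (List.map g xs) f ≈ sum xs (f ∘ g)
  sum-map []       = R.refl
  sum-map (x ∷ xs) = R.+-congˡ (sum-map xs)

  sum-cartesianProductWith : (h : A → B → C) (xs : List A) (ys : List B) {f : C → Carrier} →
    sum (List.cartesianProductWith h xs ys) f ≈ sum xs (λ x → sum ys (λ y → f (h x y)))
  sum-cartesianProductWith h []       ys = R.refl
  sum-cartesianProductWith h (x ∷ xs) ys =
    R.trans (sum-++ (List.map (h x) ys)) (+-cong (sum-map ys) (sum-cartesianProductWith h xs ys))

  sum-filter : {Φ : A → Set p} (P? : Decidable Φ) (xs : List A) {f : A → Carrier} →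
               sum (filter P? xs) f ≈ sum xs (λ x → when (P? x) (f x))
  sum-filter P? []       = R.refl
  sum-filter P? (x ∷ xs) with does (P? x)
  ... | true  = R.+-congˡ (sum-filter P? xs)
  ... | false = R.trans (sum-filter P? xs) (R.sym (R.+-identityˡ _))

  fromℕ-length-filter : {Φ : A → Set p} (P? : Decidable Φ) (xs : List A) →
                        fromℕ (length (filter P? xs)) ≈ sum xs (λ x → when (P? x) 1#)
  fromℕ-length-filter P? []       = R.refl
  fromℕ-length-filter P? (x ∷ xs) with does (P? x)
  ... | true  = R.+-congˡ (fromℕ-length-filter P? xs)
  ... | false = R.trans (fromℕ-length-filter P? xs) (R.sym (R.+-identityˡ _))

  private
    sum-absent : (y : A) {xs : List A} {f : A → Carrier} → ListAll.All (y ≢_) xs →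
                 (∀ x → x ≢ y → f x ≈ 0#) → sum xs f ≈ 0#
    sum-absent y ListAll.[]           e = R.refl
    sum-absent y (y≢x ListAll.∷ y∉) e =
      R.trans (+-cong (e _ (y≢x ∘ sym)) (sum-absent y y∉ e)) (R.+-identityˡ 0#)

  -- Existence and uniqueness become an equation between sums here: one bottom flat, one cover
  -- through an element, one composition of a flag, one composition for a word.
  sum-single : {y : A} {xs : List A} {f : A → Carrier} → Unique xs → y ∈ˡ xs →
               (∀ x → x ≢ y → f x ≈ 0#) → sum xs f ≈ f y
  sum-single {y = y} (x∉ ListAllPairs.∷ _) (here refl) e =
    R.trans (R.+-congˡ (sum-absent y x∉ e)) (R.+-identityʳ _)
  sum-single (x∉ ListAllPairs.∷ u) (there y∈) e =
    R.trans (+-cong (e _ (ListAll.lookup x∉ y∈)) (sum-single u y∈ e)) (R.+-identityˡ _)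

  fromℕ-+ : ∀ m n → fromℕ (m + n) ≈ fromℕ m R.+ fromℕ n
  fromℕ-+ = ×-homo-+ 1#

  sum-allFin-suc : ∀ n {f : Fin (suc n) → Carrier} →
                   sum (allFin (suc n)) f ≈ f zero R.+ sum (allFin n) (f ∘ suc)
  sum-allFin-suc n {f} = R.+-congˡ (R.trans
    (R.reflexive (cong (λ xs → sum xs f) (sym (List.map-tabulate id suc))))
    (sum-map (allFin n)))

  -- Opens a cardinality to double counting, since sums over sets and over their elements can then
  -- be exchanged.
  fromℕ-∣∣ : (X : Subset n) → fromℕ ∣ X ∣ ≈ sum (allFin n) (λ e → when (e ∈? X) 1#)
  fromℕ-∣∣ []            = R.refl
  fromℕ-∣∣ {suc n} (outside ∷ X) = R.sym (R.trans (sum-allFin-suc n) (R.trans (R.+-identityˡ _)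
    (R.trans (sum-cong (allFin n) λ e → when-cong (suc e ∈? (outside ∷ X)) (e ∈? X) drop-there there′ λ _ → R.refl)
      (R.sym (fromℕ-∣∣ X)))))
    where
    there′ : ∀ {e} → e ∈ X → suc e ∈ outside ∷ X
    there′ = Vec.there
  fromℕ-∣∣ {suc n} (inside ∷ X) = R.sym (R.trans (sum-allFin-suc n) (R.+-congˡ
    (R.trans (sum-cong (allFin n) λ e → when-cong (suc e ∈? (inside ∷ X)) (e ∈? X) drop-there there′ λ _ → R.refl)
      (R.sym (fromℕ-∣∣ X)))))
    where
    there′ : ∀ {e} → e ∈ X → suc e ∈ inside ∷ X
    there′ = Vec.there

-- Enumerations by words, and sizes of subsets

words-unique : {xs : List A} → Unique xs → ∀ k → Unique (words xs k)
words-unique u zero    = ListAll.[] ListAllPairs.∷ ListAllPairs.[]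
words-unique u (suc k) = Unique.cartesianProductWith⁺ _∷_ Vec.∷-injective u (words-unique u k)

∈-words : {xs : List A} {v : Vec A k} → VecAll.All (_∈ˡ xs) v → v ∈ˡ words xs k
∈-words []        = here refl
∈-words (x∈ ∷ v∈) = ∈-cartesianProductWith⁺ _∷_ x∈ (∈-words v∈)

subsets-unique : ∀ n → Unique (subsets n)
subsets-unique = words-unique (((λ ()) ListAll.∷ ListAll.[]) ListAllPairs.∷ (ListAll.[] ListAllPairs.∷ ListAllPairs.[]))

∈-subsets : (X : Subset n) → X ∈ˡ subsets n
∈-subsets X = ∈-words (VecAll.universal (λ { outside → here refl ; inside → there (here refl) }) X)

∈-─⁻ʳ : {X Y : Subset n} {e : Fin n} → e ∈ Y ─ X → e ∉ X
∈-─⁻ʳ {X = outside ∷ X} {inside ∷ Y}  {zero}  Vec.here ()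
∈-─⁻ʳ {X = inside  ∷ X} {_ ∷ Y}       {zero}  ()
∈-─⁻ʳ {X = _ ∷ X}       {_ ∷ Y}       {suc e} (Vec.there e∈) (Vec.there e∈X) = ∈-─⁻ʳ {X = X} {Y} e∈ e∈X

∣p∣+∣q─p∣≡∣q∣ : {X Y : Subset n} → X ⊆ Y → ∣ X ∣ + ∣ Y ─ X ∣ ≡ ∣ Y ∣
∣p∣+∣q─p∣≡∣q∣ {X = []}          {[]}          X⊆Y = refl
∣p∣+∣q─p∣≡∣q∣ {X = outside ∷ X} {outside ∷ Y} X⊆Y = ∣p∣+∣q─p∣≡∣q∣ (drop-∷-⊆ X⊆Y)
∣p∣+∣q─p∣≡∣q∣ {X = outside ∷ X} {inside ∷ Y}  X⊆Y = trans (ℕ.+-suc _ _) (cong suc (∣p∣+∣q─p∣≡∣q∣ (drop-∷-⊆ X⊆Y)))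
∣p∣+∣q─p∣≡∣q∣ {X = inside ∷ X}  {inside ∷ Y}  X⊆Y = cong suc (∣p∣+∣q─p∣≡∣q∣ (drop-∷-⊆ X⊆Y))
∣p∣+∣q─p∣≡∣q∣ {X = inside ∷ X}  {outside ∷ Y} X⊆Y with X⊆Y Vec.here
... | ()

p⊂q⇒0<∣q─p∣ : {X Y : Subset n} → X ⊂ Y → 0 < ∣ Y ─ X ∣
p⊂q⇒0<∣q─p∣ {X = X} {Y} (_ , e , e∈Y , e∉X) = ℕ.≤-trans (ℕ.≤-reflexive (sym (∣⁅x⁆∣≡1 e)))
  (p⊆q⇒∣p∣≤∣q∣ λ {x} x∈ → subst (_∈ Y ─ X) (sym (x∈⁅y⁆⇒x≡y e x∈)) (x∈p∧x∉q⇒x∈p─q e∈Y e∉X))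

∪-⁅⁆-⊆ : {X Y : Subset n} {e : Fin n} → X ⊆ Y → e ∈ Y → X ∪ ⁅ e ⁆ ⊆ Y
∪-⁅⁆-⊆ {X = X} {Y} {e} X⊆Y e∈Y x∈ with x∈p∪q⁻ X ⁅ e ⁆ x∈
... | inj₁ x∈X = X⊆Y x∈X
... | inj₂ x∈e = subst (_∈ Y) (sym (x∈⁅y⁆⇒x≡y e x∈e)) e∈Y

∪-⁅⁆-mono : {X Y : Subset n} {e : Fin n} → X ⊆ Y → X ∪ ⁅ e ⁆ ⊆ Y ∪ ⁅ e ⁆
∪-⁅⁆-mono {Y = Y} {e} X⊆Y = ∪-⁅⁆-⊆ (p⊆p∪q ⁅ e ⁆ ∘ X⊆Y) (q⊆p∪q Y ⁅ e ⁆ (x∈⁅x⁆ e))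

e∈X∪⁅e⁆ : (X : Subset n) (e : Fin n) → e ∈ X ∪ ⁅ e ⁆
e∈X∪⁅e⁆ X e = q⊆p∪q X ⁅ e ⁆ (x∈⁅x⁆ e)

-- Closure and covers of flats

module _ (M : Matroid n) where
  open Matroid M

  ∣∣≤rk : ∀ {I X} → I ⊆ X → Indep I → ∣ I ∣ ≤ rk X
  ∣∣≤rk {I} {X} I⊆X ind = ListAll.lookup (xs≤max 0 (List.map ∣_∣ (filter candidate? (subsets n))))
    (∈-map⁺ ∣_∣ (∈-filter⁺ candidate? (∈-subsets I) (I⊆X , ind)))
    where
    candidate? : Decidable (λ J → J ⊆ X × Indep J)
    candidate? J = (J ⊆? X) ×-dec indep? J

  rk-mono : ∀ {X Y} → X ⊆ Y → rk X ≤ rk Y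
  rk-mono {X} X⊆Y with rk-attained M X
  ... | I , I⊆X , ind , ∣I∣ = subst (_≤ _) ∣I∣ (∣∣≤rk (X⊆Y ∘ I⊆X) ind)

  rk-⊥ : rk Subset.⊥ ≡ 0
  rk-⊥ with rk-attained M Subset.⊥
  ... | I , I⊆⊥ , _ , ∣I∣ = ℕ.n≤0⇒n≡0 (subst (_≤ 0) ∣I∣ (ℕ.≤-trans (p⊆q⇒∣p∣≤∣q∣ I⊆⊥) (ℕ.≤-reflexive (∣⊥∣≡0 n))))

  -- A maximal independent subset of `X ∪ ⁅ e ⁆` loses at most `e` when it is intersected with `X`.
  rk-∪-⁅⁆ : ∀ X e → rk (X ∪ ⁅ e ⁆) ≤ suc (rk X)
  rk-∪-⁅⁆ X e with rk-attained M (X ∪ ⁅ e ⁆)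
  ... | I , I⊆ , ind , ∣I∣ = subst (_≤ _) ∣I∣ (ℕ.≤-trans (p⊆q⇒∣p∣≤∣q∣ split)
          (ℕ.≤-trans (∣p∪⁅x⁆∣≤1+∣p∣ (I ∩ X) e) (s≤s (∣∣≤rk (p∩q⊆q I X) (hereditary (p∩q⊆p I X) ind)))))
    where
    split : I ⊆ (I ∩ X) ∪ ⁅ e ⁆
    split x∈I with x∈p∪q⁻ X ⁅ e ⁆ (I⊆ x∈I)
    ... | inj₁ x∈X = x∈p∪q⁺ (inj₁ (x∈p∩q⁺ (x∈I , x∈X)))
    ... | inj₂ x∈e = x∈p∪q⁺ (inj₂ x∈e)

  extend-to-rk : ∀ {I X} → I ⊆ X → Indep I → ∃[ J ] (I ⊆ J × J ⊆ X × Indep J × ∣ J ∣ ≡ rk X)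
  extend-to-rk {I} {X} I⊆X ind = go (rk X ∸ ∣ I ∣) I⊆X ind (ℕ.m∸n+n≡m (∣∣≤rk I⊆X ind))
    where
    go : ∀ d {I} → I ⊆ X → Indep I → d + ∣ I ∣ ≡ rk X → ∃[ J ] (I ⊆ J × J ⊆ X × Indep J × ∣ J ∣ ≡ rk X)
    go zero    {I} I⊆X ind eq = I , id , I⊆X , ind , eq
    go (suc d) {I} I⊆X ind eq with rk-attained M X
    ... | J , J⊆X , indJ , ∣J∣
      with augment ind indJ (subst (∣ I ∣ <_) (trans eq (sym ∣J∣)) (s≤s (ℕ.m≤n+m ∣ I ∣ d)))
    ... | e , e∈J , e∉I , ind′
      with go d (∪-⁅⁆-⊆ I⊆X (J⊆X e∈J)) ind′ (trans (cong (d +_) (∣p∪⁅x⁆∣≡1+∣p∣ e∉I)) (trans (ℕ.+-suc d ∣ I ∣) eq))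
    ... | K , I′⊆K , rest = K , I′⊆K ∘ p⊆p∪q ⁅ e ⁆ , rest

  -- A maximal independent `J` in `X` extends to a maximal independent `K` in `Y`. If `e` raised the
  -- rank of `Y`, some `f` could be added to `K`. It cannot lie in `Y`, so it is `e`, and then `J`
  -- together with `e` shows that `e` raises the rank of `X`.
  rk-local : ∀ {X Y e} → X ⊆ Y → rk (X ∪ ⁅ e ⁆) ≤ rk X → rk (Y ∪ ⁅ e ⁆) ≤ rk Y
  rk-local {X} {Y} {e} X⊆Y eq with rk-attained M X
  ... | J , J⊆X , indJ , ∣J∣ with extend-to-rk (X⊆Y ∘ J⊆X) indJ
  ... | K , J⊆K , K⊆Y , indK , ∣K∣ with rk-attained M (Y ∪ ⁅ e ⁆)
  ... | I , I⊆ , indI , ∣I∣ = ℕ.≮⇒≥ impossible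
    where
    impossible : ¬ (rk Y < rk (Y ∪ ⁅ e ⁆))
    impossible lt with augment indK indI (subst (_< ∣ I ∣) (sym ∣K∣) (subst (rk Y <_) (sym ∣I∣) lt))
    ... | f , f∈I , f∉K , ind with x∈p∪q⁻ Y ⁅ e ⁆ (I⊆ f∈I)
    ... | inj₁ f∈Y = ℕ.1+n≰n (subst (_≤ rk Y) (trans (∣p∪⁅x⁆∣≡1+∣p∣ f∉K) (cong suc ∣K∣)) (∣∣≤rk (∪-⁅⁆-⊆ K⊆Y f∈Y) ind))
    ... | inj₂ f∈e with x∈⁅y⁆⇒x≡y e f∈e
    ... | refl = ℕ.1+n≰n (ℕ.≤-trans
          (subst (_≤ rk (X ∪ ⁅ e ⁆)) (trans (∣p∪⁅x⁆∣≡1+∣p∣ (f∉K ∘ J⊆K)) (cong suc ∣J∣))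
            (∣∣≤rk (∪-⁅⁆-mono J⊆X) (hereditary (∪-⁅⁆-mono J⊆K) ind)))
          eq)

  -- An element of `Y` outside `F` would raise the rank of `F` but not that of `X`, against
  -- `rk-local`.
  flat-absorbs : ∀ {X Y F} → IsFlat F → X ⊆ F → X ⊆ Y → rk Y ≤ rk X → Y ⊆ F
  flat-absorbs {F = F} flat X⊆F X⊆Y le {e} e∈Y with e ∈? F
  ... | yes e∈F = e∈F
  ... | no  e∉F = contradiction
    (rk-local X⊆F (ℕ.≤-trans (rk-mono (∪-⁅⁆-⊆ X⊆Y e∈Y)) le)) (ℕ.<⇒≱ (flat e e∉F))

  -- Both flats are the closure of `X`, so each absorbs the other.
  flat-unique : ∀ {X F G} → IsFlat F → IsFlat G → X ⊆ F → X ⊆ G → rk F ≤ rk X → rk G ≤ rk X → F ≡ G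
  flat-unique flatF flatG X⊆F X⊆G leF leG =
    ⊆-antisym (flat-absorbs flatG X⊆G X⊆F leF) (flat-absorbs flatF X⊆F X⊆G leG)

  flat-of-full-rank : ∀ {F} → IsFlat F → rk F ≡ rank → F ≡ ⊤
  flat-of-full-rank flat eq = ⊆-antisym ⊆⊤ (flat-absorbs flat id ⊆⊤ (ℕ.≤-reflexive (sym eq)))

  smaller-rank⇒proper : ∀ {X} → rk X < rank → ∃[ e ] (e ∈ ⊤ × e ∉ X)
  smaller-rank⇒proper {X} lt with rk-attained M ⊤
  ... | I , _ , indI , ∣I∣ with rk-attained M X
  ... | J , J⊆X , indJ , ∣J∣ with augment indJ indI (subst (_< ∣ I ∣) (sym ∣J∣) (subst (rk X <_) (sym ∣I∣) lt))
  ... | e , _ , e∉J , ind = e , ∈⊤ , λ e∈X → ℕ.1+n≰n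
        (subst (_≤ rk X) (trans (∣p∪⁅x⁆∣≡1+∣p∣ e∉J) (cong suc ∣J∣)) (∣∣≤rk (∪-⁅⁆-⊆ J⊆X e∈X) ind))

  ⊤-flat : IsFlat ⊤
  ⊤-flat x x∉⊤ = contradiction ∈⊤ x∉⊤

  rk-∪-flat : ∀ {F e} → IsFlat F → e ∉ F → rk (F ∪ ⁅ e ⁆) ≡ suc (rk F)
  rk-∪-flat {F} {e} flat e∉F = ℕ.≤-antisym (rk-∪-⁅⁆ F e) (flat e e∉F)

  cl : Subset n → Subset n
  cl X = Vec.tabulate λ e → does (rk (X ∪ ⁅ e ⁆) ℕ.≤? rk X)

  ∈-cl⁺ : ∀ {X e} → rk (X ∪ ⁅ e ⁆) ≤ rk X → e ∈ cl X
  ∈-cl⁺ {X} {e} le = Vec.lookup⇒[]= e (cl X)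
    (trans (Vec.lookup∘tabulate _ e) (dec-true (rk (X ∪ ⁅ e ⁆) ℕ.≤? rk X) le))

  ∈-cl⁻ : ∀ {X e} → e ∈ cl X → rk (X ∪ ⁅ e ⁆) ≤ rk X
  ∈-cl⁻ {X} {e} e∈ = does⇒holds (rk (X ∪ ⁅ e ⁆) ℕ.≤? rk X) (trans (sym (Vec.lookup∘tabulate _ e)) (Vec.[]=⇒lookup e∈))
    where
    does⇒holds : (p? : Dec Φ) → does p? ≡ true → Φ
    does⇒holds (yes p) _ = p

  ⊆-cl : ∀ {X} → X ⊆ cl X
  ⊆-cl {X} e∈X = ∈-cl⁺ (rk-mono (∪-⁅⁆-⊆ id e∈X))

  -- If the rank grew, a maximal independent subset of `X` could be augmented by some `e` of the
  -- closure, and `e` would raise the rank of `X` after all.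
  rk-cl : ∀ X → rk (cl X) ≡ rk X
  rk-cl X with rk-attained M X | rk-attained M (cl X)
  ... | I , I⊆X , indI , ∣I∣ | J , J⊆ , indJ , ∣J∣ = ℕ.≤-antisym (ℕ.≮⇒≥ impossible) (rk-mono ⊆-cl)
    where
    impossible : ¬ (rk X < rk (cl X))
    impossible lt with augment indI indJ (subst (_< ∣ J ∣) (sym ∣I∣) (subst (rk X <_) (sym ∣J∣) lt))
    ... | e , e∈J , e∉I , ind = ℕ.1+n≰n (ℕ.≤-trans
          (subst (_≤ rk (X ∪ ⁅ e ⁆)) (trans (∣p∪⁅x⁆∣≡1+∣p∣ e∉I) (cong suc ∣I∣)) (∣∣≤rk (∪-⁅⁆-mono I⊆X) ind))
          (∈-cl⁻ (J⊆ e∈J)))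

  cl-flat : ∀ X → IsFlat (cl X)
  cl-flat X e e∉ = subst (_< rk (cl X ∪ ⁅ e ⁆)) (sym (rk-cl X))
    (ℕ.<-≤-trans (ℕ.≰⇒> (e∉ ∘ ∈-cl⁺)) (rk-mono (∪-⁅⁆-mono ⊆-cl)))

  -- One step of a flag. Flatness is asked of the upper set only; that of `F` is supplied by the
  -- step before, or by `loops-flat` at the bottom.
  Covers : Subset n → Subset n → Set
  Covers F G = F ⊂ G × IsFlat G × rk G ≡ suc (rk F)

  covers? : ∀ F G → Dec (Covers F G)
  covers? F G = (F ⊂? G) ×-dec (isFlat? G ×-dec (rk G ℕ.≟ suc (rk F)))

  covers-cl : ∀ {F e} → IsFlat F → e ∉ F → Covers F (cl (F ∪ ⁅ e ⁆))
  covers-cl {F} {e} flat e∉F =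
      ((λ x∈F → ⊆-cl (p⊆p∪q ⁅ e ⁆ x∈F)) , e , ⊆-cl (e∈X∪⁅e⁆ F e) , e∉F)
    , cl-flat (F ∪ ⁅ e ⁆)
    , trans (rk-cl (F ∪ ⁅ e ⁆)) (rk-∪-flat flat e∉F)

  -- By rank, `G` and the closure are both flats spanned by `F` and `e`. With `covers-cl`, each
  -- element outside `F` thus lies in exactly one cover.
  covers-unique : ∀ {F G e} → IsFlat F → e ∉ F → Covers F G → e ∈ G → G ≡ cl (F ∪ ⁅ e ⁆)
  covers-unique {F} {G} {e} flat e∉F ((F⊆G , _) , flatG , rkG) e∈G =
    flat-unique flatG (cl-flat (F ∪ ⁅ e ⁆)) (∪-⁅⁆-⊆ F⊆G e∈G) ⊆-cl
      (ℕ.≤-reflexive (trans rkG (sym (rk-∪-flat flat e∉F)))) (ℕ.≤-reflexive (rk-cl (F ∪ ⁅ e ⁆)))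

  module _ {c ℓ} (R : CommutativeSemiring c ℓ) where
    open CommutativeSemiring R using (Carrier; _≈_; 1#; setoid) renaming (_*_ to _*ᴿ_)
    private module R = CommutativeSemiring R
    open Sum R
    open import Relation.Binary.Reasoning.Setoid setoid

    -- The sets G ─ F, for G covering the flat F, partition the complement of F.
    sum-covers : ∀ {F} → IsFlat F → (g : Subset n → Carrier) →
      sum (subsets n) (λ G → when (covers? F G) (fromℕ ∣ G ─ F ∣ *ᴿ g G))
        ≈ sum (allFin n) (λ e → when (¬? (e ∈? F)) (g (cl (F ∪ ⁅ e ⁆))))
    sum-covers {F} flat g = begin
      sum (subsets n) (λ G → when (covers? F G) (fromℕ ∣ G ─ F ∣ *ᴿ g G))
        ≈⟨ sum-cong (subsets n) spread ⟩
      -- The terms are now indexed by a cover and an element that it adds; swapping the sums groups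
      -- them by the element.
      sum (subsets n) (λ G → sum (allFin n) (λ e → when (covers? F G) (when (e ∈? (G ─ F)) (g G))))
        ≈⟨ sum-swap (subsets n) (allFin n) ⟩
      sum (allFin n) (λ e → sum (subsets n) (λ G → when (covers? F G) (when (e ∈? (G ─ F)) (g G))))
        ≈⟨ sum-cong (allFin n) collect ⟩
      sum (allFin n) (λ e → when (¬? (e ∈? F)) (g (cl (F ∪ ⁅ e ⁆)))) ∎
      where
      spread : ∀ G → when (covers? F G) (fromℕ ∣ G ─ F ∣ *ᴿ g G)
                   ≈ sum (allFin n) (λ e → when (covers? F G) (when (e ∈? (G ─ F)) (g G)))
      spread G = R.trans
        (when-congʳ (covers? F G) λ _ → R.trans (R.*-congʳ (fromℕ-∣∣ (G ─ F)))
          (R.trans (R.sym (sum-*ʳ (allFin n))) (sum-cong (allFin n) λ e → when-1-* (e ∈? (G ─ F)))))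
        (R.sym (sum-when (allFin n) (covers? F G)))
      collect : ∀ e → sum (subsets n) (λ G → when (covers? F G) (when (e ∈? (G ─ F)) (g G)))
                    ≈ when (¬? (e ∈? F)) (g (cl (F ∪ ⁅ e ⁆)))
      collect e with e ∈? F
      ... | yes e∈F = sum-0 (subsets n) λ G → R.trans
              (when-congʳ (covers? F G) λ _ → when-no (e ∈? (G ─ F)) λ e∈ → ∈-─⁻ʳ {X = F} {G} e∈ e∈F)
              (when-0 (covers? F G))
      ... | no  e∉F = R.trans
              (sum-single (subsets-unique n) (∈-subsets (cl (F ∪ ⁅ e ⁆))) λ G G≢ → R.trans
                (when-congʳ (covers? F G) λ cov → when-no (e ∈? (G ─ F)) λ e∈ →
                  G≢ (covers-unique flat e∉F cov (p─q⊆p G F e∈)))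
                (when-0 (covers? F G)))
              (R.trans (when-yes (covers? F (cl (F ∪ ⁅ e ⁆))) (covers-cl flat e∉F))
                (when-yes (e ∈? (cl (F ∪ ⁅ e ⁆) ─ F)) (x∈p∧x∉q⇒x∈p─q (⊆-cl (e∈X∪⁅e⁆ F e)) e∉F)))

-- Flags, read from the bottom flat upwards

-- The recursive counterpart of `IsFlag`, with the bottom flat split off. Each cover raises the rank
-- by one, so an induction has to remember only the current flat.
FlagFrom : Matroid n → Subset n → Vec (Subset n) m → Set
FlagFrom M F []       = F ≡ ⊤
FlagFrom M F (X ∷ Xs) = Covers M F X × FlagFrom M X Xs

flagFrom? : (M : Matroid n) (F : Subset n) (Xs : Vec (Subset n) m) → Dec (FlagFrom M F Xs)
flagFrom? M F []       = Vec.≡-dec Bool._≟_ F ⊤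
flagFrom? M F (X ∷ Xs) = covers? M F X ×-dec flagFrom? M X Xs

gaps : Subset n → Vec (Subset n) m → Vec ℕ m
gaps F []       = []
gaps F (X ∷ Xs) = ∣ X ─ F ∣ ∷ gaps X Xs

flagComposition-∷ : (F : Subset n) (Xs : Vec (Subset n) m) → flagComposition (F ∷ Xs) ≡ ∣ F ∣ ∷ gaps F Xs
flagComposition-∷ F []       = refl
flagComposition-∷ F (X ∷ Xs) = cong (λ v → ∣ F ∣ ∷ ∣ X ─ F ∣ ∷ tail v) (flagComposition-∷ X Xs)

module _ (M : Matroid n) where
  open Matroid M

  private
    -- `IsFlag` with its ranks shifted by `j`, because the upper part of a flag no longer starts at
    -- rank 0.
    IsFlagAt : ℕ → Vec (Subset n) (suc r) → Set
    IsFlagAt {r} j X =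
        (∀ (i : Fin r) → lookup X (inject₁ i) ⊂ lookup X (suc i))
      × (∀ i → IsFlat (lookup X i))
      × (∀ i → rk (lookup X i) ≡ j + toℕ i)
      × Vec.last X ≡ ⊤

    flagFrom : ∀ j {F} (Xs : Vec (Subset n) m) → IsFlagAt j (F ∷ Xs) → FlagFrom M F Xs
    flagFrom j []       (_ , _ , _ , top) = top
    flagFrom j (X ∷ Xs) (inc , flat , rank , top) =
      (inc zero , flat (suc zero) ,
        trans (rank (suc zero)) (trans (ℕ.+-suc j 0) (cong suc (sym (rank zero))))) ,
      flagFrom (suc j) Xs (inc ∘ suc , flat ∘ suc , (λ i → trans (rank (suc i)) (ℕ.+-suc j (toℕ i))) , top)

    isFlagAt : ∀ j {F} (Xs : Vec (Subset n) m) → IsFlat F → rk F ≡ j → FlagFrom M F Xs → IsFlagAt j (F ∷ Xs)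
    isFlagAt j []       flat rank top =
      (λ ()) , (λ { zero → flat }) , (λ { zero → trans rank (sym (ℕ.+-identityʳ j)) }) , top
    isFlagAt j (X ∷ Xs) flat rank ((F⊂X , flatX , rkX) , fl)
      with isFlagAt (suc j) Xs flatX (trans rkX (cong suc rank)) fl
    ... | inc , flats , ranks , top =
        (λ { zero → F⊂X ; (suc i) → inc i })
      , (λ { zero → flat ; (suc i) → flats i })
      , (λ { zero → trans rank (sym (ℕ.+-identityʳ j)) ; (suc i) → trans (ranks i) (sym (ℕ.+-suc j (toℕ i))) })
      , top

  loops : Subset n
  loops = cl M Subset.⊥

  loops-flat : IsFlat loops
  loops-flat = cl-flat M Subset.⊥

  rk-loops : rk loops ≡ 0
  rk-loops = trans (rk-cl M Subset.⊥) (rk-⊥ M)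

  isFlag⁺ : (Xs : Vec (Subset n) m) → FlagFrom M loops Xs → IsFlag M (loops ∷ Xs)
  isFlag⁺ Xs = isFlagAt 0 Xs loops-flat rk-loops

  -- A flat of rank 0 is spanned by the empty set, hence equals its closure.
  isFlag⁻ : ∀ {F} (Xs : Vec (Subset n) m) → IsFlag M (F ∷ Xs) → F ≡ loops × FlagFrom M F Xs
  isFlag⁻ {F = F} Xs isFlag@(_ , flat , rank , _) =
    flat-unique M (flat zero) loops-flat ⊥⊆ ⊥⊆
      (ℕ.≤-trans (ℕ.≤-reflexive (rank zero)) z≤n) (ℕ.≤-reflexive (rk-cl M Subset.⊥)) ,
    flagFrom 0 Xs isFlag

  flagFrom-sum : ∀ {F} (Xs : Vec (Subset n) m) → FlagFrom M F Xs → ∣ F ∣ + Vec.sum (gaps F Xs) ≡ n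
  flagFrom-sum []       refl = trans (ℕ.+-identityʳ _) (∣⊤∣≡n n)
  flagFrom-sum {F = F} (X ∷ Xs) (((F⊆X , _) , _) , fl) =
    trans (sym (ℕ.+-assoc ∣ F ∣ _ _)) (trans (cong (_+ Vec.sum (gaps X Xs)) (∣p∣+∣q─p∣≡∣q∣ F⊆X)) (flagFrom-sum Xs fl))

  flagFrom-positive : ∀ {F} (Xs : Vec (Subset n) m) → FlagFrom M F Xs → VecAll.All (0 <_) (gaps F Xs)
  flagFrom-positive []       _                = []
  flagFrom-positive (X ∷ Xs) ((F⊂X , _) , fl) = p⊂q⇒0<∣q─p∣ F⊂X ∷ flagFrom-positive Xs fl

  flagComposition-isComposition : (X : Vec (Subset n) (suc r)) → IsFlag M X → IsComposition n r (flagComposition X)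
  flagComposition-isComposition {r} (F ∷ Xs) isFlag = subst (IsComposition n r) (sym (flagComposition-∷ F Xs))
    (flagFrom-positive Xs (proj₂ (isFlag⁻ Xs isFlag)) , flagFrom-sum Xs (proj₂ (isFlag⁻ Xs isFlag)))

  module _ {c ℓ} (R : CommutativeSemiring c ℓ) where
    private module R = CommutativeSemiring R
    open Sum R

    sum-flags : (f : Vec (Subset n) (suc r) → R.Carrier) →
      sum (words (subsets n) (suc r)) (λ X → when (isFlag? M X) (f X))
        R.≈ sum (words (subsets n) r) (λ Xs → when (flagFrom? M loops Xs) (f (loops ∷ Xs)))
    sum-flags {r} f = R.trans (sum-cartesianProductWith _∷_ (subsets n) (words (subsets n) r))
      (R.trans
        (sum-single (subsets-unique n) (∈-subsets loops) λ F F≢ → sum-0 (words (subsets n) r) λ Xs →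
          when-no (isFlag? M (F ∷ Xs)) (F≢ ∘ proj₁ ∘ isFlag⁻ Xs))
        (sum-cong (words (subsets n) r) λ Xs →
          when-cong (isFlag? M (loops ∷ Xs)) (flagFrom? M loops Xs) (proj₂ ∘ isFlag⁻ Xs) (isFlag⁺ Xs) λ _ → R.refl))

    -- Conditioning on the next flat: the later sums over flags are all reduced through this
    -- recursion.
    sum-flagFrom-∷ : ∀ F (f : Vec (Subset n) (suc m) → R.Carrier) →
      sum (words (subsets n) (suc m)) (λ Xs → when (flagFrom? M F Xs) (f Xs))
        R.≈ sum (subsets n) (λ X → when (covers? M F X)
              (sum (words (subsets n) m) (λ Xs → when (flagFrom? M X Xs) (f (X ∷ Xs)))))
    sum-flagFrom-∷ {m} F f = R.trans
      (sum-cartesianProductWith _∷_ (subsets n) (words (subsets n) m))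
      (sum-cong (subsets n) λ X → R.trans
        (sum-cong (words (subsets n) m) λ Xs → when-× (covers? M F X) (flagFrom? M X Xs))
        (sum-when (words (subsets n) m) (covers? M F X)))

-- The coefficients of γ

-- Drawing the first of `suc k` elements. The library's `_P_` returns 0 when there are too few
-- elements, and both sides come down to the same comparison, so the identity survives outside the
-- range.
P-suc : ∀ t k → t P (suc k) ≡ t * ((t ∸ 1) P k)
P-suc zero    k       = refl
P-suc (suc t) zero    = refl
P-suc (suc t) (suc k) with k <ᵇ t
... | true  = nP′k≡n[n∸1P′k∸1] (suc t) (suc (suc k))
... | false = sym (ℕ.*-zeroʳ (suc t))

-- The part of γ-coeff with indices j ≥ 1, where p and q are the sums of the
-- preceding parts of a and b.
γ-tail : ℕ → ℕ → Vec ℕ m → Vec ℕ m → ℕ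
γ-tail p q []       []       = 1
γ-tail p q (a ∷ as) (b ∷ bs) = a * ((a ∸ 1 + (p ∸ q)) P (b ∸ 1)) * γ-tail (p + a) (q + b) as bs

-- The factors of `γ-coeff` refer to prefixes of the whole compositions. Accumulating the removed
-- parts makes the product recursive, which the induction along a flag requires.
γ-coeff-∷ : ∀ p q (as bs : Vec ℕ m) → γ-coeff (p ∷ as) (q ∷ bs) ≡ (p P q) * γ-tail p q as bs
γ-coeff-∷ p q as bs = cong ((p P q) *_) (product-γ-factor p q as bs)
  where
  γ-factor′ : ℕ → ℕ → Vec ℕ m → Vec ℕ m → Fin m → ℕ
  γ-factor′ p q as bs j = lookup as j *
    ((lookup as j ∸ 1 + (p + prefix as (toℕ j) ∸ (q + prefix bs (toℕ j)))) P (lookup bs j ∸ 1))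

  product-γ-factor : ∀ p q (as bs : Vec ℕ m) →
    List.foldr _*_ 1 (List.map (γ-factor′ p q as bs) (allFin m)) ≡ γ-tail p q as bs
  product-γ-factor p q []       []       = refl
  product-γ-factor {suc m} p q (a ∷ as) (b ∷ bs) = cong₂ _*_
    (cong (λ t → a * ((a ∸ 1 + t) P (b ∸ 1))) (cong₂ _∸_ (ℕ.+-identityʳ p) (ℕ.+-identityʳ q)))
    (trans (cong (List.foldr _*_ 1)
        (trans (List.map-tabulate suc (γ-factor′ p q (a ∷ as) (b ∷ bs)))
        (trans (sym (List.map-tabulate id (γ-factor′ p q (a ∷ as) (b ∷ bs) ∘ suc)))
          (List.map-cong (λ j → cong (λ t → lookup as j * ((lookup as j ∸ 1 + t) P (lookup bs j ∸ 1)))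
            (cong₂ _∸_ (sym (ℕ.+-assoc p a _)) (sym (ℕ.+-assoc q b _)))) (allFin m)))))
      (product-γ-factor (p + a) (q + b) as bs))

n<k⇒nPk≡0 : ∀ {t k} → t < k → t P k ≡ 0
n<k⇒nPk≡0 {t} {k} lt with k ≤ᵇ t | ℕ.≤ᵇ⇒≤ k t
... | true  | le = contradiction (le _) (ℕ.<⇒≱ lt)
... | false | _  = refl

-- At the first index where the prefix of `bs` overtakes that of `as`, the falling factorial has
-- more factors than its argument allows and vanishes. The hypothesis `q ≤ p` says that this has not
-- happened before, and keeps `p ∸ q` an honest difference.
γ-tail-⋬ : ∀ p q (as bs : Vec ℕ m) → VecAll.All (0 <_) as → q ≤ p →
  ¬ (∀ (j : Fin m) → q + prefix bs (suc (toℕ j)) ≤ p + prefix as (suc (toℕ j))) → γ-tail p q as bs ≡ 0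
γ-tail-⋬ p q []           []       _          _   ¬⊵ = contradiction (λ ()) ¬⊵
γ-tail-⋬ p q (suc a ∷ as) (b ∷ bs) (_ ∷ as>0) q≤p ¬⊵ with q + b ℕ.≤? p + suc a
... | yes le = trans (cong (suc a * ((a + (p ∸ q)) P (b ∸ 1)) *_)
        (γ-tail-⋬ (p + suc a) (q + b) as bs as>0 le λ ⊵ → ¬⊵ λ where
          zero    → subst (_≤ p + (suc a + 0)) (cong (q +_) (sym (ℕ.+-identityʳ b)))
                      (subst (q + b ≤_) (cong (p +_) (sym (ℕ.+-identityʳ (suc a)))) le)
          (suc j) → subst (_≤ p + (suc a + prefix as (suc (toℕ j)))) (ℕ.+-assoc q b (prefix bs (suc (toℕ j))))
                      (subst (q + b + prefix bs (suc (toℕ j)) ≤_) (ℕ.+-assoc p (suc a) _) (⊵ j))))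
      (ℕ.*-zeroʳ (suc a * ((a + (p ∸ q)) P (b ∸ 1))))
... | no ≰ = trans (cong (λ t → suc a * t * γ-tail (p + suc a) (q + b) as bs) (n<k⇒nPk≡0 (bound b (ℕ.≰⇒> ≰))))
      (cong (_* γ-tail (p + suc a) (q + b) as bs) (ℕ.*-zeroʳ (suc a)))
  where
  open ℕ.≤-Reasoning
  bound : ∀ b → p + suc a < q + b → a + (p ∸ q) < b ∸ 1
  -- The truncation in `b ∸ 1` does no harm, since a part that makes the prefix overtake is
  -- positive.
  bound zero    lt = contradiction q≤p (ℕ.<⇒≱ (ℕ.≤-<-trans (ℕ.m≤m+n p (suc a)) (subst (p + suc a <_) (ℕ.+-identityʳ q) lt)))
  bound (suc b) lt = ℕ.+-cancelˡ-< q _ _ (ℕ.≤-pred (begin-strict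
    suc (q + (a + (p ∸ q))) ≡⟨ cong (λ t → suc (q + t)) (ℕ.+-comm a (p ∸ q)) ⟩
    suc (q + (p ∸ q + a))   ≡⟨ cong suc (ℕ.+-assoc q (p ∸ q) a) ⟨
    suc (q + (p ∸ q) + a)   ≡⟨ cong (λ t → suc (t + a)) (ℕ.m+[n∸m]≡n q≤p) ⟩
    suc (p + a)             ≡⟨ ℕ.+-suc p a ⟨
    p + suc a               <⟨ lt ⟩
    q + suc b               ≡⟨ ℕ.+-suc q b ⟩
    suc (q + b)             ∎))

-- With this, the sum defining γ may be taken over all compositions.
γ-coeff-⋬ : {a b : Vec ℕ (suc r)} → VecAll.All (0 <_) (tail a) → ¬ (b ⊵ a) → γ-coeff a b ≡ 0
γ-coeff-⋬ {a = p ∷ as} {q ∷ bs} as>0 ¬⊵ with q ℕ.≤? p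
... | yes q≤p = trans (γ-coeff-∷ p q as bs) (trans (cong ((p P q) *_) (γ-tail-⋬ p q as bs as>0 q≤p λ ⊵ → ¬⊵ λ where
        zero    → ℕ.+-monoˡ-≤ 0 q≤p
        (suc j) → ⊵ j)) (ℕ.*-zeroʳ (p P q)))
... | no  q≰p = trans (γ-coeff-∷ p q as bs) (cong (_* γ-tail p q as bs) (n<k⇒nPk≡0 (ℕ.≰⇒> q≰p)))

-- Compositions and 0,1-words

word-injective : {b b′ : Vec ℕ (suc r)} → VecAll.All (0 <_) (tail b) → VecAll.All (0 <_) (tail b′) →
                 word b ≡ word b′ → b ≡ b′
word-injective {b = zero ∷ []}         {zero ∷ []}           _ _ _  = refl
-- Behind the 1, the `b` zeros of its block become the new leading run. Parts 0 and 1 would both be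
-- written as a bare 1, which is where positivity enters.
word-injective {b = zero ∷ suc b ∷ bs} {zero ∷ suc b′ ∷ bs′} (_ ∷ bs>0) (_ ∷ bs′>0) eq
  with refl ← word-injective {b = b ∷ bs} {b′ ∷ bs′} bs>0 bs′>0 (List.∷-injectiveʳ eq) = refl
word-injective {b = suc z ∷ bs}        {suc z′ ∷ bs′}        bs>0 bs′>0 eq
  with refl ← word-injective {b = z ∷ bs} {z′ ∷ bs′} bs>0 bs′>0 (List.∷-injectiveʳ eq) = refl
word-injective {b = zero ∷ []}         {suc z′ ∷ bs′}        _ _ ()
word-injective {b = suc z ∷ bs}        {zero ∷ []}           _ _ ()
word-injective {b = zero ∷ suc b ∷ bs} {suc z′ ∷ bs′}        _ _ ()
word-injective {b = suc z ∷ bs}        {zero ∷ suc b′ ∷ bs′} _ _ ()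

-- The composition is built from the right end of the word: a 0 lengthens the leading run `z`, and a
-- 1 turns that run into a block of size `suc z` and opens an empty run.
word-surjective : ∀ {s} → ListAll.All (_≤ 1) s →
  ∃[ b ] (VecAll.All (0 <_) (tail {n = ListAction.sum s} b) × Vec.sum b ≡ length s × word b ≡ s)
word-surjective ListAll.[] = 0 ∷ [] , [] , refl , refl
word-surjective {zero ∷ s} (_ ListAll.∷ s≤1) with word-surjective s≤1
... | z ∷ bs , bs>0 , sum≡ , word≡ = suc z ∷ bs , bs>0 , cong suc sum≡ , cong (0 ∷_) word≡
word-surjective {suc zero ∷ s} (_ ListAll.∷ s≤1) with word-surjective s≤1
... | z ∷ bs , bs>0 , sum≡ , word≡ = 0 ∷ suc z ∷ bs , s≤s z≤n ∷ bs>0 , cong suc sum≡ , cong (1 ∷_) word≡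
word-surjective {suc (suc _) ∷ s} (s≤s () ListAll.∷ _)

∈-compositions : {a : Vec ℕ (suc r)} → IsComposition n r a → a ∈ˡ compositions n r
∈-compositions {r} {n} {a} comp@(_ , sum≡) = ∈-filter⁺ (isComposition? n r)
  (∈-words (VecAll.map (λ x≤n → ∈-upTo⁺ (s≤s x≤n)) (subst (λ t → VecAll.All (_≤ t) a) sum≡ (parts≤sum a)))) comp
  where
  parts≤sum : (v : Vec ℕ k) → VecAll.All (_≤ Vec.sum v) v
  parts≤sum []      = []
  parts≤sum (x ∷ v) = ℕ.m≤m+n x _ ∷ VecAll.map (λ y≤ → ℕ.≤-trans y≤ (ℕ.m≤n+m _ x)) (parts≤sum v)

compositions-unique : ∀ n r → Unique (compositions n r)
compositions-unique n r = Unique.filter⁺ (isComposition? n r) (words-unique (Unique.upTo⁺ (suc n)) (suc r))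

-- Counting orderings with a given rank sequence

module Orderings (M : Matroid n) where
  open Matroid M
  open Sum ℕ.+-*-commutativeSemiring
  open ≡-Reasoning

  fromℕ-id : ∀ m → fromℕ m ≡ m
  fromℕ-id zero    = refl
  fromℕ-id (suc m) = cong suc (fromℕ-id m)

  -- The number of ways to continue an ordering whose elements so far form `U`, with the next rank
  -- increments prescribed by the list. The order within `U` has no influence on them.
  completions : Subset n → List ℕ → ℕ
  completions U []      = 1
  completions U (b ∷ s) = sum (allFin n) λ e →
    when (¬? (e ∈? U)) (when ((rk (U ∪ ⁅ e ⁆) ∸ rk U) ℕ.≟ b) (completions (U ∪ ⁅ e ⁆) s))

  Completes : Subset n → List ℕ → Vec (Fin n) m → Set
  Completes U s π = AllPairs _≢_ π × VecAll.All (_∉ U) π × increments M U π ≡ s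

  completes? : (U : Subset n) (s : List ℕ) (π : Vec (Fin n) m) → Dec (Completes U s π)
  completes? U s π = AllPairs.allPairs? (λ x y → ¬? (x Fin.≟ y)) π ×-dec
    (VecAll.all? (λ x → ¬? (x ∈? U)) π ×-dec List.≡-dec ℕ._≟_ (increments M U π) s)

  completes-∷⁺ : ∀ {U s b e} {π : Vec (Fin n) m} →
    (e ∉ U × rk (U ∪ ⁅ e ⁆) ∸ rk U ≡ b) × Completes (U ∪ ⁅ e ⁆) s π → Completes U (b ∷ s) (e ∷ π)
  completes-∷⁺ {U = U} {e = e} ((e∉U , refl) , distinct , avoids , refl) =
      VecAll.map (λ x∉ e≡x → x∉ (subst (_∈ U ∪ ⁅ e ⁆) e≡x (e∈X∪⁅e⁆ U e))) avoids ∷ distinct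
    , e∉U ∷ VecAll.map (λ x∉ x∈U → x∉ (p⊆p∪q ⁅ e ⁆ x∈U)) avoids
    , refl

  completes-∷⁻ : ∀ {U s b e} {π : Vec (Fin n) m} →
    Completes U (b ∷ s) (e ∷ π) → (e ∉ U × rk (U ∪ ⁅ e ⁆) ∸ rk U ≡ b) × Completes (U ∪ ⁅ e ⁆) s π
  completes-∷⁻ {U = U} {e = e} (e≢ ∷ distinct , e∉U ∷ avoids , eq) =
      (e∉U , List.∷-injectiveˡ eq)
    , distinct
    , VecAll.map (λ (e≢x , x∉U) x∈ → avoid e≢x x∉U x∈) (VecAll.zip (e≢ , avoids))
    , List.∷-injectiveʳ eq
    where
    avoid : ∀ {x} → e ≢ x → x ∉ U → x ∉ U ∪ ⁅ e ⁆
    avoid e≢x x∉U x∈ with x∈p∪q⁻ U ⁅ e ⁆ x∈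
    ... | inj₁ x∈U = x∉U x∈U
    ... | inj₂ x∈e = e≢x (sym (x∈⁅y⁆⇒x≡y e x∈e))

  count-completions : ∀ U s → sum (words (allFin n) (length s)) (λ π → when (completes? U s π) 1) ≡ completions U s
  count-completions U []      = refl
  count-completions U (b ∷ s) = trans
    (sum-cartesianProductWith _∷_ (allFin n) (words (allFin n) (length s)))
    (sum-cong (allFin n) λ e → let U′ = U ∪ ⁅ e ⁆ ; d? = (rk U′ ∸ rk U) ℕ.≟ b in begin
      sum (words (allFin n) (length s)) (λ π → when (completes? U (b ∷ s) (e ∷ π)) 1)
        ≡⟨ sum-cong (words (allFin n) (length s)) (λ π → trans
             (when-cong (completes? U (b ∷ s) (e ∷ π)) ((¬? (e ∈? U) ×-dec d?) ×-dec completes? U′ s π)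
               completes-∷⁻ completes-∷⁺ λ _ → refl)
             (when-× (¬? (e ∈? U) ×-dec d?) (completes? U′ s π))) ⟩
      sum (words (allFin n) (length s)) (λ π → when (¬? (e ∈? U) ×-dec d?) (when (completes? U′ s π) 1))
        ≡⟨ sum-when (words (allFin n) (length s)) (¬? (e ∈? U) ×-dec d?) ⟩
      when (¬? (e ∈? U) ×-dec d?) (sum (words (allFin n) (length s)) (λ π → when (completes? U′ s π) 1))
        ≡⟨ when-congʳ (¬? (e ∈? U) ×-dec d?) (λ _ → count-completions U′ s) ⟩
      when (¬? (e ∈? U) ×-dec d?) (completions U′ s)
        ≡⟨ when-× (¬? (e ∈? U)) d? ⟩
      when (¬? (e ∈? U)) (when d? (completions U′ s)) ∎)

  count-orderings : ∀ {s} → length s ≡ n →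
    sum (orderings n) (λ π → when (List.≡-dec ℕ._≟_ (rankSequence M π) s) 1) ≡ completions Subset.⊥ s
  count-orderings {s} eq = begin
    sum (orderings n) (λ π → when (List.≡-dec ℕ._≟_ (rankSequence M π) s) 1)
      ≡⟨ sum-filter distinct? (words (allFin n) n) ⟩
    sum (words (allFin n) n) (λ π → when (distinct? π) (when (List.≡-dec ℕ._≟_ (rankSequence M π) s) 1))
      ≡⟨ sum-cong (words (allFin n) n) (λ π → trans
           (sym (when-× (distinct? π) (List.≡-dec ℕ._≟_ (rankSequence M π) s)))
           (when-cong (distinct? π ×-dec List.≡-dec ℕ._≟_ (rankSequence M π) s) (completes? Subset.⊥ s π)
             (λ (distinct , eq) → distinct , VecAll.universal (λ _ → ∉⊥) π , eq)
             (λ (distinct , _ , eq) → distinct , eq) λ _ → refl)) ⟩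
    sum (words (allFin n) n) (λ π → when (completes? Subset.⊥ s π) 1)
      -- The length is rewritten because `count-completions` recurses on the word.
      ≡⟨ cong (λ k → sum (words (allFin n) k) (λ π → when (completes? Subset.⊥ s π) 1)) (sym eq) ⟩
    sum (words (allFin n) (length s)) (λ π → when (completes? Subset.⊥ s π) 1)
      ≡⟨ count-completions Subset.⊥ s ⟩
    completions Subset.⊥ s ∎
    where
    distinct? : Decidable (AllPairs _≢_)
    distinct? = AllPairs.allPairs? λ x y → ¬? (x Fin.≟ y)

-- Orderings grouped by the flags of their closures

module OrderingsAlongFlags (M : Matroid n) where
  open Matroid M
  open Orderings M using (fromℕ-id; completions; count-orderings)
  open Sum ℕ.+-*-commutativeSemiring
  open ≡-Reasoning

  -- The share of all flags above `F` in the count, where `q` is the number of elements placed when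
  -- the ordering leaves `F`.
  flagWeight : Subset n → ℕ → Vec ℕ m → ℕ
  flagWeight {m = m} F q bs =
    sum (words (subsets n) m) (λ Xs → when (flagFrom? M F Xs) (γ-tail ∣ F ∣ q (gaps F Xs) bs))

  -- On the way to the cover `X` there are `∣ X ─ F ∣` choices for the 1, and then `b` zeros are
  -- drawn from the `∣ X ∣ ∸ suc q` elements of `X` still free. This is the argument of the falling
  -- factorial in γ, because the parts of the composition up to `X` add up to `∣ X ∣`.
  flagWeight-∷ : ∀ F {q} (b : ℕ) (bs : Vec ℕ m) → q ≤ ∣ F ∣ →
    flagWeight F q (suc b ∷ bs) ≡ sum (subsets n) (λ X → when (covers? M F X)
      (fromℕ ∣ X ─ F ∣ * (((∣ X ∣ ∸ suc q) P b) * flagWeight X (suc q + b) bs)))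
  flagWeight-∷ {m} F {q} b bs q≤ = trans
    (sum-flagFrom-∷ M ℕ.+-*-commutativeSemiring F (λ Xs → γ-tail ∣ F ∣ q (gaps F Xs) (suc b ∷ bs)))
    (sum-cong (subsets n) λ X →
      when-congʳ (covers? M F X) λ cov → begin
        sum (words (subsets n) m) (λ Xs → when (flagFrom? M X Xs)
          (∣ X ─ F ∣ * ((∣ X ─ F ∣ ∸ 1 + (∣ F ∣ ∸ q)) P b) * γ-tail (∣ F ∣ + ∣ X ─ F ∣) (q + suc b) (gaps X Xs) bs))
          ≡⟨ sum-cong (words (subsets n) m) (λ Xs → trans
               (when-congʳ (flagFrom? M X Xs) λ _ → cong₂ _*_
                  (cong₂ (λ u v → u * (v P b)) (sym (fromℕ-id ∣ X ─ F ∣)) (remaining (∣p∣+∣q─p∣≡∣q∣ {X = F} {X} (proj₁ (proj₁ cov))) (p⊂q⇒0<∣q─p∣ {X = F} {X} (proj₁ cov))))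
                  (cong₂ (λ u v → γ-tail u v (gaps X Xs) bs) (∣p∣+∣q─p∣≡∣q∣ {X = F} {X} (proj₁ (proj₁ cov))) (ℕ.+-suc q b)))
               (sym (when-*ˡ (flagFrom? M X Xs) {fromℕ ∣ X ─ F ∣ * ((∣ X ∣ ∸ suc q) P b)}))) ⟩
        sum (words (subsets n) m) (λ Xs → fromℕ ∣ X ─ F ∣ * ((∣ X ∣ ∸ suc q) P b) *
          when (flagFrom? M X Xs) (γ-tail ∣ X ∣ (suc q + b) (gaps X Xs) bs))
          ≡⟨ sum-*ˡ (words (subsets n) m) {fromℕ ∣ X ─ F ∣ * ((∣ X ∣ ∸ suc q) P b)} ⟩
        fromℕ ∣ X ─ F ∣ * ((∣ X ∣ ∸ suc q) P b) * flagWeight X (suc q + b) bs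
          ≡⟨ ℕ.*-assoc (fromℕ ∣ X ─ F ∣) ((∣ X ∣ ∸ suc q) P b) _ ⟩
        fromℕ ∣ X ─ F ∣ * (((∣ X ∣ ∸ suc q) P b) * flagWeight X (suc q + b) bs) ∎)
    where
    remaining : ∀ {x d} → ∣ F ∣ + d ≡ x → 0 < d → d ∸ 1 + (∣ F ∣ ∸ q) ≡ x ∸ suc q
    remaining {d = suc d} refl _ = begin
      d + (∣ F ∣ ∸ q)       ≡⟨ ℕ.+-∸-assoc d q≤ ⟨
      d + ∣ F ∣ ∸ q         ≡⟨ cong (_∸ q) (ℕ.+-comm d ∣ F ∣) ⟩
      suc (∣ F ∣ + d) ∸ suc q ≡⟨ cong (_∸ suc q) (ℕ.+-suc ∣ F ∣ d) ⟨
      ∣ F ∣ + suc d ∸ suc q ∎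

  -- Induction along the word, with `F` the closure of the used set `U`: a 0 stays inside `F`, a 1
  -- leads to a cover. The equation `rk F + m ≡ rank` says that the remaining 1s are just enough to
  -- reach `⊤`.
  completions-word : ∀ z (bs : Vec ℕ m) {U F} → VecAll.All (0 <_) bs → IsFlat F → U ⊆ F → rk F ≤ rk U →
    rk F + m ≡ rank → completions U (word (z ∷ bs)) ≡ ((∣ F ∣ ∸ ∣ U ∣) P z) * flagWeight F (∣ U ∣ + z) bs
  -- The rank forces `F` to be `⊤`, so the empty chain is a flag and matches the single empty
  -- completion.
  completions-word zero [] {U} {F} _ flat U⊆F rk≤ rank≡ = sym (trans (ℕ.+-identityʳ _) (trans (ℕ.+-identityʳ _)
    (when-yes (Vec.≡-dec Bool._≟_ F ⊤) (flat-of-full-rank M flat (trans (sym (ℕ.+-identityʳ _)) rank≡)))))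
  completions-word {m = suc m} zero (suc b ∷ bs) {U} {F} (_ ∷ bs>0) flat U⊆F rk≤ rank≡ = begin
    sum (allFin n) (λ e → when (¬? (e ∈? U)) (when ((rk (U ∪ ⁅ e ⁆) ∸ rk U) ℕ.≟ 1) (completions (U ∪ ⁅ e ⁆) (word (b ∷ bs)))))
      ≡⟨ sum-cong (allFin n) step ⟩
    sum (allFin n) (λ e → when (¬? (e ∈? F)) (g (cl M (F ∪ ⁅ e ⁆))))
      ≡⟨ sum-covers M ℕ.+-*-commutativeSemiring flat g ⟨
    sum (subsets n) (λ X → when (covers? M F X) (fromℕ ∣ X ─ F ∣ * g X))
      ≡⟨ flagWeight-∷ F b bs (p⊆q⇒∣p∣≤∣q∣ U⊆F) ⟨
    flagWeight F ∣ U ∣ (suc b ∷ bs)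
      ≡⟨ cong (λ q → flagWeight F q (suc b ∷ bs)) (ℕ.+-identityʳ ∣ U ∣) ⟨
    flagWeight F (∣ U ∣ + 0) (suc b ∷ bs)
      ≡⟨ ℕ.+-identityʳ _ ⟨
    1 * flagWeight F (∣ U ∣ + 0) (suc b ∷ bs) ∎
    where
    -- What follows the 1 depends on the chosen element only through the cover reached, so
    -- `sum-covers` can group the choices.
    g : Subset n → ℕ
    g X = ((∣ X ∣ ∸ suc ∣ U ∣) P b) * flagWeight X (suc ∣ U ∣ + b) bs

    outside-flat : ∀ {e} → e ∉ U × rk (U ∪ ⁅ e ⁆) ∸ rk U ≡ 1 → e ∉ F
    outside-flat (_ , eq) e∈F = contradiction (trans (sym eq)
      (ℕ.m≤n⇒m∸n≡0 (ℕ.≤-trans (rk-mono M (∪-⁅⁆-⊆ U⊆F e∈F)) rk≤))) λ ()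

    rk-up : ∀ {e} → e ∉ F → rk U < rk (U ∪ ⁅ e ⁆)
    rk-up {e} e∉F = ℕ.≰⇒> λ le → e∉F (flat-absorbs M flat U⊆F (p⊆p∪q ⁅ e ⁆) le (e∈X∪⁅e⁆ U e))

    raises-rank : ∀ {e} → e ∉ F → e ∉ U × rk (U ∪ ⁅ e ⁆) ∸ rk U ≡ 1
    raises-rank {e} e∉F = e∉F ∘ U⊆F , trans (cong (_∸ rk U) (ℕ.≤-antisym (rk-∪-⁅⁆ M U e) (rk-up e∉F))) (ℕ.m+n∸n≡m 1 (rk U))

    step : ∀ e → when (¬? (e ∈? U)) (when ((rk (U ∪ ⁅ e ⁆) ∸ rk U) ℕ.≟ 1) (completions (U ∪ ⁅ e ⁆) (word (b ∷ bs))))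
               ≡ when (¬? (e ∈? F)) (g (cl M (F ∪ ⁅ e ⁆)))
    step e = trans (sym (when-× (¬? (e ∈? U)) ((rk (U ∪ ⁅ e ⁆) ∸ rk U) ℕ.≟ 1)))
      (when-cong (¬? (e ∈? U) ×-dec ((rk (U ∪ ⁅ e ⁆) ∸ rk U) ℕ.≟ 1)) (¬? (e ∈? F)) outside-flat raises-rank λ (e∉U , eq) →
        let e∉F = outside-flat (e∉U , eq)
            rk-cl≡ = trans (rk-cl M (F ∪ ⁅ e ⁆)) (rk-∪-flat M flat e∉F)
        in trans
          (completions-word b bs {U ∪ ⁅ e ⁆} {cl M (F ∪ ⁅ e ⁆)} bs>0 (cl-flat M (F ∪ ⁅ e ⁆))
            (λ x∈ → ⊆-cl M (∪-⁅⁆-mono U⊆F x∈))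
            (ℕ.≤-trans (ℕ.≤-reflexive rk-cl≡) (ℕ.≤-trans (s≤s rk≤) (rk-up e∉F)))
            (trans (cong (_+ m) rk-cl≡) (trans (sym (ℕ.+-suc (rk F) m)) rank≡)))
          (cong (λ u → ((∣ cl M (F ∪ ⁅ e ⁆) ∣ ∸ u) P b) * flagWeight (cl M (F ∪ ⁅ e ⁆)) (u + b) bs) (∣p∪⁅x⁆∣≡1+∣p∣ e∉U)))
  -- A 0 is chosen among the elements of `F ─ U`, whose number is the first factor of the falling
  -- factorial, and leaves `F` unchanged.
  completions-word (suc z) bs {U} {F} bs>0 flat U⊆F rk≤ rank≡ = begin
    sum (allFin n) (λ e → when (¬? (e ∈? U)) (when ((rk (U ∪ ⁅ e ⁆) ∸ rk U) ℕ.≟ 0) (completions (U ∪ ⁅ e ⁆) (word (z ∷ bs)))))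
      ≡⟨ sum-cong (allFin n) step ⟩
    sum (allFin n) (λ e → when (e ∈? (F ─ U)) 1 * tailCount)
      ≡⟨ sum-*ʳ (allFin n) ⟩
    sum (allFin n) (λ e → when (e ∈? (F ─ U)) 1) * tailCount
      ≡⟨ cong (_* tailCount) (trans (sym (fromℕ-∣∣ (F ─ U))) (trans (fromℕ-id ∣ F ─ U ∣) size)) ⟩
    (∣ F ∣ ∸ ∣ U ∣) * tailCount
      ≡⟨ ℕ.*-assoc (∣ F ∣ ∸ ∣ U ∣) _ _ ⟨
    (∣ F ∣ ∸ ∣ U ∣) * ((∣ F ∣ ∸ ∣ U ∣ ∸ 1) P z) * flagWeight F (∣ U ∣ + suc z) bs
      ≡⟨ cong (_* flagWeight F (∣ U ∣ + suc z) bs) (P-suc (∣ F ∣ ∸ ∣ U ∣) z) ⟨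
    ((∣ F ∣ ∸ ∣ U ∣) P suc z) * flagWeight F (∣ U ∣ + suc z) bs ∎
    where
    tailCount : ℕ
    tailCount = ((∣ F ∣ ∸ ∣ U ∣ ∸ 1) P z) * flagWeight F (∣ U ∣ + suc z) bs

    size : ∣ F ─ U ∣ ≡ ∣ F ∣ ∸ ∣ U ∣
    size = sym (trans (cong (_∸ ∣ U ∣) (trans (sym (∣p∣+∣q─p∣≡∣q∣ {X = U} {F} U⊆F)) (ℕ.+-comm ∣ U ∣ _))) (ℕ.m+n∸n≡m ∣ F ─ U ∣ ∣ U ∣))

    inside-flat : ∀ {e} → e ∉ U × rk (U ∪ ⁅ e ⁆) ∸ rk U ≡ 0 → e ∈ F ─ U
    inside-flat {e} (e∉U , eq) = x∈p∧x∉q⇒x∈p─q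
      (flat-absorbs M flat U⊆F (p⊆p∪q ⁅ e ⁆) (ℕ.m∸n≡0⇒m≤n eq) (e∈X∪⁅e⁆ U e)) e∉U

    keeps-rank : ∀ {e} → e ∈ F ─ U → e ∉ U × rk (U ∪ ⁅ e ⁆) ∸ rk U ≡ 0
    keeps-rank e∈ = ∈-─⁻ʳ {X = U} {F} e∈ , ℕ.m≤n⇒m∸n≡0 (ℕ.≤-trans (rk-mono M (∪-⁅⁆-⊆ U⊆F (p─q⊆p F U e∈))) rk≤)

    step : ∀ e → when (¬? (e ∈? U)) (when ((rk (U ∪ ⁅ e ⁆) ∸ rk U) ℕ.≟ 0) (completions (U ∪ ⁅ e ⁆) (word (z ∷ bs))))
               ≡ when (e ∈? (F ─ U)) 1 * tailCount
    step e = trans (sym (when-× (¬? (e ∈? U)) ((rk (U ∪ ⁅ e ⁆) ∸ rk U) ℕ.≟ 0)))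
      (trans (when-cong (¬? (e ∈? U) ×-dec ((rk (U ∪ ⁅ e ⁆) ∸ rk U) ℕ.≟ 0)) (e ∈? (F ─ U)) inside-flat keeps-rank λ (e∉U , eq) →
        trans
          (completions-word z bs {U ∪ ⁅ e ⁆} {F} bs>0 flat
            (∪-⁅⁆-⊆ U⊆F (p─q⊆p F U (inside-flat (e∉U , eq))))
            (ℕ.≤-trans rk≤ (rk-mono M (p⊆p∪q ⁅ e ⁆))) rank≡)
          (trans (cong (λ u → ((∣ F ∣ ∸ u) P z) * flagWeight F (u + z) bs) (∣p∪⁅x⁆∣≡1+∣p∣ e∉U))
            (cong₂ (λ u v → (u P z) * flagWeight F v bs)
              (trans (cong (∣ F ∣ ∸_) (ℕ.+-comm 1 ∣ U ∣)) (sym (ℕ.∸-+-assoc ∣ F ∣ ∣ U ∣ 1)))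
              (sym (ℕ.+-suc ∣ U ∣ z)))))
        (sym (when-1-* (e ∈? (F ─ U)))))

  -- An ordering starts with nothing used and the loops as its closure, so the leading zeros
  -- contribute the factor of γ with index 0.
  count-orderings-word : (b : Vec ℕ (suc r)) → IsComposition n r b → r ≡ rank → length (word b) ≡ n →
    sum (orderings n) (λ π → when (List.≡-dec ℕ._≟_ (rankSequence M π) (word b)) 1)
      ≡ sum (words (subsets n) (suc r)) (λ X → when (isFlag? M X) (γ-coeff (flagComposition X) b))
  count-orderings-word {r} (z ∷ bs) (bs>0 , _) r≡ len = begin
    sum (orderings n) (λ π → when (List.≡-dec ℕ._≟_ (rankSequence M π) (word (z ∷ bs))) 1)
      ≡⟨ count-orderings len ⟩
    completions Subset.⊥ (word (z ∷ bs))
      ≡⟨ completions-word z bs bs>0 (loops-flat M) (⊆-cl M) (ℕ.≤-reflexive (rk-cl M Subset.⊥)) (trans (cong (_+ r) (rk-loops M)) r≡) ⟩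
    ((∣ loops M ∣ ∸ ∣ Subset.⊥ {n} ∣) P z) * flagWeight (loops M) (∣ Subset.⊥ {n} ∣ + z) bs
      ≡⟨ cong (λ u → ((∣ loops M ∣ ∸ u) P z) * flagWeight (loops M) (u + z) bs) (∣⊥∣≡0 n) ⟩
    (∣ loops M ∣ P z) * flagWeight (loops M) z bs
      ≡⟨ sum-*ˡ (words (subsets n) r) {∣ loops M ∣ P z} ⟨
    sum (words (subsets n) r) (λ Xs → (∣ loops M ∣ P z) * when (flagFrom? M (loops M) Xs) (γ-tail ∣ loops M ∣ z (gaps (loops M) Xs) bs))
      ≡⟨ sum-cong (words (subsets n) r) (λ Xs → trans (when-*ˡ (flagFrom? M (loops M) Xs) {∣ loops M ∣ P z})
           (when-congʳ (flagFrom? M (loops M) Xs) λ _ → trans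
             (sym (γ-coeff-∷ ∣ loops M ∣ z (gaps (loops M) Xs) bs))
             (cong (λ a → γ-coeff a (z ∷ bs)) (sym (flagComposition-∷ (loops M) Xs))))) ⟩
    sum (words (subsets n) r) (λ Xs → when (flagFrom? M (loops M) Xs) (γ-coeff (flagComposition (loops M ∷ Xs)) (z ∷ bs)))
      ≡⟨ sum-flags M ℕ.+-*-commutativeSemiring (λ X → γ-coeff (flagComposition X) (z ∷ bs)) ⟨
    sum (words (subsets n) (suc r)) (λ X → when (isFlag? M X) (γ-coeff (flagComposition X) (z ∷ bs))) ∎

-- Truncation

module Truncation (M : Matroid n) (pos : 0 < Matroid.rank M) {t : ℕ} (rank≡ : Matroid.rank M ≡ suc t) where
  private
    module M = Matroid M
    T = Trun M pos
    module T = Matroid T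

  -- An independent set of the truncation lies in an `M`-independent set of size `t`, which bounds
  -- the rank from above. Conversely, a maximal independent subset of `X` stays independent if its
  -- size is at most `t`; otherwise its size is `suc t`, and one element is removed.
  rk-Trun : ∀ X → T.rk X ≡ M.rk X ⊓ t
  rk-Trun X = ℕ.≤-antisym upper lower
    where
    upper : T.rk X ≤ M.rk X ⊓ t
    upper with rk-attained T X
    ... | I , I⊆X , (B , I⊆B , indB , ∣B∣) , ∣I∣ = subst (_≤ M.rk X ⊓ t) ∣I∣ (ℕ.⊓-glb
      (∣∣≤rk M I⊆X (M.hereditary I⊆B indB))
      (ℕ.≤-trans (p⊆q⇒∣p∣≤∣q∣ I⊆B) (ℕ.≤-reflexive (ℕ.suc-injective (trans ∣B∣ rank≡)))))

    indep-below : ∀ {I} → M.Indep I → ∣ I ∣ ≤ t → T.Indep I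
    indep-below {I} ind le = extend′ M ind (subst (∣ I ∣ <_) (sym rank≡) (s≤s le))

    lower : M.rk X ⊓ t ≤ T.rk X
    lower with rk-attained M X
    ... | I , I⊆X , ind , ∣I∣ with ∣ I ∣ ℕ.≤? t
    ... | yes ≤t = ℕ.≤-trans (ℕ.m⊓n≤m (M.rk X) t) (subst (_≤ T.rk X) ∣I∣ (∣∣≤rk T I⊆X (indep-below ind ≤t)))
    -- Augmenting the empty set from `I` merely supplies an element to remove.
    ... | no  ≰t with M.augment M.empty ind (ℕ.≤-<-trans (ℕ.≤-reflexive (∣⊥∣≡0 n)) (ℕ.≤-<-trans z≤n (ℕ.≰⇒> ≰t)))
    ... | e , e∈I , _ = ℕ.≤-trans (ℕ.m⊓n≤n (M.rk X) t)
      (subst (_≤ T.rk X) ∣I-e∣ (∣∣≤rk T (I⊆X ∘ p─q⊆p I ⁅ e ⁆)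
        (indep-below (M.hereditary (p─q⊆p I ⁅ e ⁆) ind) (ℕ.≤-reflexive ∣I-e∣))))
      where
      e⊆I : ⁅ e ⁆ ⊆ I
      e⊆I x∈ = subst (_∈ I) (sym (x∈⁅y⁆⇒x≡y e x∈)) e∈I
      ∣I-e∣ : ∣ I - e ∣ ≡ t
      ∣I-e∣ = ℕ.suc-injective (trans (cong (_+ ∣ I - e ∣) (sym (∣⁅x⁆∣≡1 e)))
        (trans (∣p∣+∣q─p∣≡∣q∣ {X = ⁅ e ⁆} {I} e⊆I)
          (ℕ.≤-antisym (subst (∣ I ∣ ≤_) rank≡ (∣∣≤rk M ⊆⊤ ind)) (ℕ.≰⇒> ≰t))))

  rank-Trun : T.rank ≡ t
  rank-Trun = trans (rk-Trun ⊤) (ℕ.m≥n⇒m⊓n≡n (ℕ.≤-trans (ℕ.n≤1+n t) (ℕ.≤-reflexive (sym rank≡))))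

  rk-Trun-≤ : ∀ {X} → M.rk X ≤ t → T.rk X ≡ M.rk X
  rk-Trun-≤ {X} le = trans (rk-Trun X) (ℕ.m≤n⇒m⊓n≡m le)

  rk-Trun-< : ∀ {X} → T.rk X < t → T.rk X ≡ M.rk X
  rk-Trun-< {X} lt = rk-Trun-≤ (ℕ.≮⇒≥ λ gt → ℕ.<⇒≢ lt (trans (rk-Trun X) (ℕ.m≥n⇒m⊓n≡n (ℕ.<⇒≤ gt))))

  -- One more element takes the rank to at most `t`, where the two rank functions still agree.
  flat-Trun⁺ : ∀ {X} → M.rk X < t → M.IsFlat X → T.IsFlat X
  flat-Trun⁺ {X} lt flat x x∉X = subst (_< T.rk (X ∪ ⁅ x ⁆)) (sym (rk-Trun-≤ (ℕ.<⇒≤ lt)))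
    (subst (M.rk X <_) (sym (rk-Trun-≤ (ℕ.≤-trans (rk-∪-⁅⁆ M X x) lt))) (flat x x∉X))

  flat-Trun⁻ : ∀ {X} → M.rk X < t → T.IsFlat X → M.IsFlat X
  flat-Trun⁻ {X} lt flat x x∉X = ℕ.<-≤-trans (subst (_< T.rk (X ∪ ⁅ x ⁆)) (rk-Trun-≤ (ℕ.<⇒≤ lt)) (flat x x∉X))
    (ℕ.≤-trans (ℕ.≤-reflexive (rk-Trun (X ∪ ⁅ x ⁆))) (ℕ.m⊓n≤m _ t))

  -- The bound keeps `X` below rank `t`; at rank `t` the hyperplanes of `M` cease to be flats of the
  -- truncation.
  covers-Trun⁺ : ∀ {F X} → suc (M.rk F) < t → Covers M F X → Covers T F X
  covers-Trun⁺ {F} {X} lt (F⊂X , flat , rkX) = F⊂X , flat-Trun⁺ rkX<t flat ,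
    trans (rk-Trun-≤ (ℕ.<⇒≤ rkX<t)) (trans rkX (cong suc (sym (rk-Trun-≤ (ℕ.<⇒≤ (ℕ.<⇒≤ lt))))))
    where
    rkX<t : M.rk X < t
    rkX<t = subst (_< t) (sym rkX) lt

  covers-Trun⁻ : ∀ {F X} → suc (M.rk F) < t → Covers T F X → Covers M F X
  covers-Trun⁻ {F} {X} lt (F⊂X , flat , rkX) = F⊂X , flat-Trun⁻ (subst (_< t) (sym rkX≡) lt) flat , rkX≡
    where
    rkX≡suc : T.rk X ≡ suc (M.rk F)
    rkX≡suc = trans rkX (cong suc (rk-Trun-≤ (ℕ.<⇒≤ (ℕ.<⇒≤ lt))))
    rkX≡ : M.rk X ≡ suc (M.rk F)
    rkX≡ = trans (sym (rk-Trun-< (subst (_< t) (sym rkX≡suc) lt))) rkX≡suc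

  -- The last step of a flag of the truncation, which passes over the hyperplanes of `M`.
  covers-Trun-⊤ : ∀ {F} → suc (M.rk F) ≡ t → Covers T F ⊤
  covers-Trun-⊤ {F} eq = (⊆⊤ , smaller-rank⇒proper M (subst (M.rk F <_) (sym rank≡) (s≤s rkF≤t))) , ⊤-flat T , trans rank-Trun (trans (sym eq) (cong suc (sym (rk-Trun-≤ rkF≤t))))
    where
    rkF≤t : M.rk F ≤ t
    rkF≤t = ℕ.≤-trans (ℕ.n≤1+n _) (ℕ.≤-reflexive eq)

  -- For `t = 0` truncation would turn every element into a loop. For positive `t` its flat of rank
  -- 0 is also a flat of rank 0 in `M`, where there is only one.
  loops-Trun : 0 < t → loops T ≡ loops M
  loops-Trun 0<t = flat-unique M
    (flat-Trun⁻ (subst (_< t) (sym rk≡0) 0<t) (loops-flat T)) (loops-flat M) ⊥⊆ ⊥⊆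
    (ℕ.≤-trans (ℕ.≤-reflexive rk≡0) z≤n) (ℕ.≤-reflexive (rk-cl M Subset.⊥))
    where
    rk≡0 : M.rk (loops T) ≡ 0
    rk≡0 = trans (sym (rk-Trun-< (subst (_< t) (sym (rk-loops T)) 0<t))) (rk-loops T)

-- Weighted sums over flags of a matroid and of its truncation

mergeLast : Vec ℕ (2 + m) → Vec ℕ (1 + m)
mergeLast a = init (init a) ∷ʳ (last (init a) + last a)

-- The common interface of ratio and ratioᴷ, through which both parts of the
-- proposition become instances of sum-flags-Trun.
record Fractions {c ℓ} (R : CommutativeSemiring c ℓ) : Set (c Level.⊔ ℓ) where
  open CommutativeSemiring R renaming (_*_ to _*ᴿ_)
  open Sum R using (fromℕ)
  field
    fraction     : ℕ → ℕ → Carrier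
    1/suc        : ℕ → Carrier
    fraction-suc : ∀ x b → fraction x (suc b) ≈ fromℕ x *ᴿ 1/suc b
    inverseʳ     : ∀ b → fromℕ (suc b) *ᴿ 1/suc b ≈ 1#

module FlagSums {c ℓ} (R : CommutativeSemiring c ℓ) (fractions : Fractions R) where
  private module R = CommutativeSemiring R
  open R using (Carrier; _≈_; 1#) renaming (_*_ to _*ᴿ_)
  open Sum R
  open Fractions fractions
  open import Relation.Binary.Reasoning.Setoid R.setoid

  lastFraction : Vec ℕ (2 + m) → Carrier
  lastFraction a = fraction (last (init a)) (last (init a) + last a)

  -- The constant `v` is averaged over the covers of `F`, each weighted by the share of the
  -- complement that it adds. In its application the covers are hyperplanes.
  sum-hyperplanes : ∀ (M : Matroid n) {F} → Matroid.IsFlat M F → F ⊂ ⊤ → (v : Carrier) →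
    sum (subsets n) (λ H → when (covers? M F H) (fraction ∣ H ─ F ∣ ∣ ⊤ ─ F ∣ *ᴿ v)) ≈ v
  sum-hyperplanes {n} M {F} flat F⊂⊤ v = go ∣ ⊤ ─ F ∣ refl (p⊂q⇒0<∣q─p∣ {X = F} {⊤} F⊂⊤)
    where
    -- The denominator is generalised to a variable so that it can be matched as a successor, where
    -- `fraction` is a genuine quotient.
    go : ∀ d → d ≡ ∣ ⊤ ─ F ∣ → 0 < d →
         sum (subsets n) (λ H → when (covers? M F H) (fraction ∣ H ─ F ∣ d *ᴿ v)) ≈ v
    go (suc d) d≡ _ = begin
      sum (subsets n) (λ H → when (covers? M F H) (fraction ∣ H ─ F ∣ (suc d) *ᴿ v))
        ≈⟨ sum-cong (subsets n) (λ H → when-congʳ (covers? M F H) λ _ →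
             R.trans (R.*-congʳ (fraction-suc ∣ H ─ F ∣ d)) (R.*-assoc _ _ _)) ⟩
      sum (subsets n) (λ H → when (covers? M F H) (fromℕ ∣ H ─ F ∣ *ᴿ (1/suc d *ᴿ v)))
        ≈⟨ sum-covers M R flat (λ _ → 1/suc d *ᴿ v) ⟩
      sum (allFin n) (λ e → when (¬? (e ∈? F)) (1/suc d *ᴿ v))
        ≈⟨ sum-cong (allFin n) (λ e → R.trans
             (when-cong (¬? (e ∈? F)) (e ∈? (⊤ ─ F)) (x∈p∧x∉q⇒x∈p─q ∈⊤) (∈-─⁻ʳ {X = F} {⊤}) λ _ → R.refl)
             (R.sym (when-1-* (e ∈? (⊤ ─ F))))) ⟩
      sum (allFin n) (λ e → when (e ∈? (⊤ ─ F)) 1# *ᴿ (1/suc d *ᴿ v))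
        ≈⟨ sum-*ʳ (allFin n) ⟩
      sum (allFin n) (λ e → when (e ∈? (⊤ ─ F)) 1#) *ᴿ (1/suc d *ᴿ v)
        ≈⟨ R.*-congʳ (R.sym (fromℕ-∣∣ (⊤ ─ F))) ⟩
      fromℕ ∣ ⊤ ─ F ∣ *ᴿ (1/suc d *ᴿ v)
        ≈⟨ R.*-congʳ (R.reflexive (cong fromℕ (sym d≡))) ⟩
      fromℕ (suc d) *ᴿ (1/suc d *ᴿ v)
        ≈⟨ R.*-assoc _ _ _ ⟨
      (fromℕ (suc d) *ᴿ 1/suc d) *ᴿ v
        ≈⟨ R.*-congʳ (inverseʳ d) ⟩
      1# *ᴿ v
        ≈⟨ R.*-identityˡ v ⟩
      v ∎

  sum-flagFrom-[] : ∀ (M : Matroid n) F (f : Vec (Subset n) 1 → Carrier) → Covers M F ⊤ →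
    sum (words (subsets n) 1) (λ Xs → when (flagFrom? M F Xs) (f Xs)) ≈ f (⊤ ∷ [])
  sum-flagFrom-[] {n} M F f cov = R.trans (sum-flagFrom-∷ M R F f)
    (R.trans
      (sum-single (subsets-unique n) (∈-subsets ⊤) λ X X≢⊤ → R.trans
        (when-congʳ (covers? M F X) λ _ → R.trans (R.+-identityʳ _) (when-no (flagFrom? M X []) X≢⊤))
        (when-0 (covers? M F X)))
      (R.trans (when-yes (covers? M F ⊤) cov)
        (R.trans (R.+-identityʳ _) (when-yes (flagFrom? M ⊤ []) refl))))

  module _ (M : Matroid n) (pos : 0 < Matroid.rank M) {k : ℕ} (rank≡ : Matroid.rank M ≡ 2 + k) where
    open Matroid M using (rk)
    open Truncation M pos rank≡

    -- Here `m` is the number of covers shared by the two kinds of flag before they part at rank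
    -- `k`. For `m = 0` the flags of `M` pass through a hyperplane, while the truncation goes
    -- straight to `⊤`.
    sum-flagFrom-Trun : ∀ m {F} (h : Vec ℕ (1 + m) → Carrier) → Matroid.IsFlat M F → rk F + m ≡ k →
      sum (words (subsets n) (2 + m)) (λ Xs → when (flagFrom? M F Xs) (lastFraction (gaps F Xs) *ᴿ h (mergeLast (gaps F Xs))))
        ≈ sum (words (subsets n) (1 + m)) (λ Xs → when (flagFrom? (Trun M pos) F Xs) (h (gaps F Xs)))
    sum-flagFrom-Trun zero {F} h flat rkF = begin
      sum (words (subsets n) 2) (λ Xs → when (flagFrom? M F Xs) (lastFraction (gaps F Xs) *ᴿ h (mergeLast (gaps F Xs))))
        ≈⟨ sum-flagFrom-∷ M R F (λ Xs → lastFraction (gaps F Xs) *ᴿ h (mergeLast (gaps F Xs))) ⟩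
      sum (subsets n) (λ H → when (covers? M F H) (sum (words (subsets n) 1) (λ Xs → when (flagFrom? M H Xs)
        (lastFraction (gaps F (H ∷ Xs)) *ᴿ h (mergeLast (gaps F (H ∷ Xs)))))))
        ≈⟨ sum-cong (subsets n) (λ H → when-congʳ (covers? M F H) λ cov → R.trans
             (sum-flagFrom-[] M H (λ Xs → lastFraction (gaps F (H ∷ Xs)) *ᴿ h (mergeLast (gaps F (H ∷ Xs)))) (covers-⊤ cov))
             (R.reflexive (cong (λ d → fraction ∣ H ─ F ∣ d *ᴿ h (d ∷ [])) (complement (proj₁ (proj₁ cov)))))) ⟩
      sum (subsets n) (λ H → when (covers? M F H) (fraction ∣ H ─ F ∣ ∣ ⊤ ─ F ∣ *ᴿ h (∣ ⊤ ─ F ∣ ∷ [])))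
        ≈⟨ sum-hyperplanes M flat (proj₁ covers-F-⊤) (h (∣ ⊤ ─ F ∣ ∷ [])) ⟩
      h (∣ ⊤ ─ F ∣ ∷ [])
        ≈⟨ sum-flagFrom-[] (Trun M pos) F (λ Xs → h (gaps F Xs)) covers-F-⊤ ⟨
      sum (words (subsets n) 1) (λ Xs → when (flagFrom? (Trun M pos) F Xs) (h (gaps F Xs))) ∎
      where
      rkF≡k : rk F ≡ k
      rkF≡k = trans (sym (ℕ.+-identityʳ _)) rkF
      covers-F-⊤ : Covers (Trun M pos) F ⊤
      covers-F-⊤ = covers-Trun-⊤ (cong suc rkF≡k)
      covers-⊤ : ∀ {H} → Covers M F H → Covers M H ⊤
      covers-⊤ {H} (_ , _ , rkH) = (⊆⊤ , proper) , ⊤-flat M , ⊤-rank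
        where
        ⊤-rank : rk ⊤ ≡ suc (rk H)
        ⊤-rank = trans rank≡ (cong suc (sym (trans rkH (cong suc rkF≡k))))
        proper : ∃[ e ] (e ∈ ⊤ × e ∉ H)
        proper = smaller-rank⇒proper M (ℕ.≤-reflexive (sym ⊤-rank))
      -- The merged last part does not depend on the hyperplane, so `h` is constant over the sum,
      -- and the denominator is the one of `sum-hyperplanes`.
      complement : ∀ {H} → F ⊆ H → ∣ H ─ F ∣ + ∣ ⊤ ─ H ∣ ≡ ∣ ⊤ ─ F ∣
      complement {H} F⊆H = ℕ.+-cancelˡ-≡ ∣ F ∣ _ _ (trans (sym (ℕ.+-assoc ∣ F ∣ _ _))
        (trans (cong (_+ ∣ ⊤ ─ H ∣) (∣p∣+∣q─p∣≡∣q∣ {X = F} {H} F⊆H))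
          (trans (∣p∣+∣q─p∣≡∣q∣ {X = H} {⊤} ⊆⊤) (sym (∣p∣+∣q─p∣≡∣q∣ {X = F} {⊤} ⊆⊤)))))
    sum-flagFrom-Trun (suc m) {F} h flat rkF = begin
      sum (words (subsets n) (3 + m)) (λ Xs → when (flagFrom? M F Xs) (lastFraction (gaps F Xs) *ᴿ h (mergeLast (gaps F Xs))))
        ≈⟨ sum-flagFrom-∷ M R F (λ Xs → lastFraction (gaps F Xs) *ᴿ h (mergeLast (gaps F Xs))) ⟩
      sum (subsets n) (λ X → when (covers? M F X) (sum (words (subsets n) (2 + m)) (λ Xs → when (flagFrom? M X Xs)
        (lastFraction (gaps X Xs) *ᴿ h (∣ X ─ F ∣ ∷ mergeLast (gaps X Xs))))))
        ≈⟨ sum-cong (subsets n) (λ X → when-cong (covers? M F X) (covers? (Trun M pos) F X)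
             (covers-Trun⁺ low) (covers-Trun⁻ low) λ (_ , flatX , rkX) →
               -- The gap shared by both flags is absorbed into `h`; hence the induction runs over
               -- all functions `h`.
               sum-flagFrom-Trun m {X} (λ v → h (∣ X ─ F ∣ ∷ v)) flatX (trans (cong (_+ m) rkX) (trans (sym (ℕ.+-suc (rk F) m)) rkF))) ⟩
      sum (subsets n) (λ X → when (covers? (Trun M pos) F X) (sum (words (subsets n) (1 + m)) (λ Xs → when (flagFrom? (Trun M pos) X Xs)
        (h (∣ X ─ F ∣ ∷ gaps X Xs)))))
        ≈⟨ sum-flagFrom-∷ (Trun M pos) R F (λ Xs → h (gaps F Xs)) ⟨
      sum (words (subsets n) (2 + m)) (λ Xs → when (flagFrom? (Trun M pos) F Xs) (h (gaps F Xs))) ∎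
      where
      low : suc (rk F) < 1 + k
      low = s≤s (subst (suc (rk F) ≤_) rkF (ℕ.≤-trans (ℕ.≤-reflexive (ℕ.+-comm 1 (rk F))) (ℕ.+-monoʳ-≤ (rk F) (s≤s z≤n))))

    sum-flags-Trun : (h : Vec ℕ (2 + k) → Carrier) →
      sum (words (subsets n) (3 + k)) (λ X → when (isFlag? M X)
          (lastFraction (flagComposition X) *ᴿ h (mergeLast (flagComposition X))))
        ≈ sum (words (subsets n) (2 + k)) (λ X → when (isFlag? (Trun M pos) X) (h (flagComposition X)))
    sum-flags-Trun h = begin
      sum (words (subsets n) (3 + k)) (λ X → when (isFlag? M X)
          (lastFraction (flagComposition X) *ᴿ h (mergeLast (flagComposition X))))
        ≈⟨ sum-flags M R (λ X → lastFraction (flagComposition X) *ᴿ h (mergeLast (flagComposition X))) ⟩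
      sum (words (subsets n) (2 + k)) (λ Xs → when (flagFrom? M F Xs)
          (lastFraction (flagComposition (F ∷ Xs)) *ᴿ h (mergeLast (flagComposition (F ∷ Xs)))))
        ≈⟨ sum-cong (words (subsets n) (2 + k)) (λ Xs → when-congʳ (flagFrom? M F Xs) λ _ →
             R.reflexive (cong (λ a → lastFraction a *ᴿ h (mergeLast a)) (flagComposition-∷ F Xs))) ⟩
      sum (words (subsets n) (2 + k)) (λ Xs → when (flagFrom? M F Xs)
          (lastFraction (gaps F Xs) *ᴿ h (∣ F ∣ ∷ mergeLast (gaps F Xs))))
        ≈⟨ sum-flagFrom-Trun k (λ v → h (∣ F ∣ ∷ v)) (loops-flat M) (cong (_+ k) (rk-loops M)) ⟩
      sum (words (subsets n) (1 + k)) (λ Xs → when (flagFrom? (Trun M pos) F Xs) (h (∣ F ∣ ∷ gaps F Xs)))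
        ≈⟨ sum-cong (words (subsets n) (1 + k)) (λ Xs → when-congʳ (flagFrom? (Trun M pos) F Xs) λ _ →
             R.reflexive (cong h (sym (flagComposition-∷ F Xs)))) ⟩
      sum (words (subsets n) (1 + k)) (λ Xs → when (flagFrom? (Trun M pos) F Xs) (h (flagComposition (F ∷ Xs))))
        -- The bottom flats agree because the truncation has the positive rank `1 + k`.
        ≈⟨ R.reflexive (cong (λ F → sum (words (subsets n) (1 + k)) (λ Xs → when (flagFrom? (Trun M pos) F Xs) (h (flagComposition (F ∷ Xs)))))
             (sym (loops-Trun (s≤s z≤n)))) ⟩
      sum (words (subsets n) (1 + k)) (λ Xs → when (flagFrom? (Trun M pos) F′ Xs) (h (flagComposition (F′ ∷ Xs))))
        ≈⟨ sum-flags (Trun M pos) R (λ X → h (flagComposition X)) ⟨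
      sum (words (subsets n) (2 + k)) (λ X → when (isFlag? (Trun M pos) X) (h (flagComposition X))) ∎
      where
      F  = loops M
      F′ = loops (Trun M pos)


-- Splitting the last part, and counting flags by composition

mergeLast-∷ʳ : ∀ (a : Vec ℕ m) x y → mergeLast (a ∷ʳ x ∷ʳ y) ≡ a ∷ʳ (x + y)
mergeLast-∷ʳ a x y = cong₂ _∷ʳ_
  (trans (cong init (Vec.init-∷ʳ y (a ∷ʳ x))) (Vec.init-∷ʳ x a))
  (cong₂ _+_ (trans (cong last (Vec.init-∷ʳ y (a ∷ʳ x))) (Vec.last-∷ʳ x a)) (Vec.last-∷ʳ y (a ∷ʳ x)))

All-∷ʳ⁻ : ∀ {Φ : A → Set p} (v : Vec A m) {x} → VecAll.All Φ (v ∷ʳ x) → VecAll.All Φ v × Φ x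
All-∷ʳ⁻ []      (px ∷ [])  = [] , px
All-∷ʳ⁻ (_ ∷ v) (px ∷ pvs) = px ∷ proj₁ (All-∷ʳ⁻ v pvs) , proj₂ (All-∷ʳ⁻ v pvs)

splitLastTwo : (c : Vec A (2 + m)) → ∃[ b ] ∃[ x ] ∃[ y ] c ≡ b ∷ʳ x ∷ʳ y
splitLastTwo c with Vec.initLast c
... | c′ , y , refl with Vec.initLast c′
... | b , x , refl = b , x , y , refl

IsSplitting : ℕ → ℕ × ℕ → Set
IsSplitting s (x , y) = 0 < x × 0 < y × x + y ≡ s

isSplitting? : ∀ s → Decidable (IsSplitting s)
isSplitting? s p = (0 ℕ.<? proj₁ p) ×-dec ((0 ℕ.<? proj₂ p) ×-dec (proj₁ p + proj₂ p ℕ.≟ s))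

∈-splittings : ∀ {s x y} → IsSplitting s (x , y) → (x , y) ∈ˡ splittings s
∈-splittings {s} {x} {y} spl@(_ , _ , refl) = ∈-filter⁺ (isSplitting? s)
  (∈-cartesianProduct⁺ (∈-upTo⁺ (s≤s (ℕ.m≤m+n x y))) (∈-upTo⁺ (s≤s (ℕ.m≤n+m y x)))) spl

splittings-unique : ∀ s → Unique (splittings s)
splittings-unique s = Unique.filter⁺ (isSplitting? s)
  (Unique.cartesianProduct⁺ (Unique.upTo⁺ (suc s)) (Unique.upTo⁺ (suc s)))

module FlagCounts {c ℓ} (R : CommutativeSemiring c ℓ) where
  private module R = CommutativeSemiring R
  open R using (Carrier; _≈_; 1#) renaming (_*_ to _*ᴿ_)
  open Sum R
  open import Relation.Binary.Reasoning.Setoid R.setoid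

  -- Trades weighted flag counts for a sum over the flags themselves. The family `a` is general
  -- because it serves both the splittings of one part and the list of all compositions.
  sum-ν : ∀ (M : Matroid n) (xs : List A) (a : A → Vec ℕ (suc r)) (g : A → Carrier) →
    sum xs (λ x → fromℕ (ν M (a x)) *ᴿ g x)
      ≈ sum (words (subsets n) (suc r)) (λ X → when (isFlag? M X)
          (sum xs (λ x → when (Vec.≡-dec ℕ._≟_ (flagComposition X) (a x)) (g x))))
  sum-ν {n} {r = r} M xs a g = begin
    sum xs (λ x → fromℕ (ν M (a x)) *ᴿ g x)
      ≈⟨ sum-cong xs (λ x → R.trans
           (R.*-congʳ (fromℕ-length-filter (λ X → isFlag? M X ×-dec Vec.≡-dec ℕ._≟_ (flagComposition X) (a x)) (words (subsets n) (suc r))))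
           (R.sym (sum-*ʳ (words (subsets n) (suc r))))) ⟩
    sum xs (λ x → sum (words (subsets n) (suc r)) (λ X →
      when (isFlag? M X ×-dec Vec.≡-dec ℕ._≟_ (flagComposition X) (a x)) 1# *ᴿ g x))
      ≈⟨ sum-cong xs (λ x → sum-cong (words (subsets n) (suc r)) λ X → R.trans
           (when-1-* (isFlag? M X ×-dec Vec.≡-dec ℕ._≟_ (flagComposition X) (a x)))
           (when-× (isFlag? M X) (Vec.≡-dec ℕ._≟_ (flagComposition X) (a x)))) ⟩
    sum xs (λ x → sum (words (subsets n) (suc r)) (λ X →
      when (isFlag? M X) (when (Vec.≡-dec ℕ._≟_ (flagComposition X) (a x)) (g x))))
      ≈⟨ sum-swap xs (words (subsets n) (suc r)) ⟩
    sum (words (subsets n) (suc r)) (λ X → sum xs (λ x →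
      when (isFlag? M X) (when (Vec.≡-dec ℕ._≟_ (flagComposition X) (a x)) (g x))))
      ≈⟨ sum-cong (words (subsets n) (suc r)) (λ X → sum-when xs (isFlag? M X)) ⟩
    sum (words (subsets n) (suc r)) (λ X → when (isFlag? M X)
      (sum xs (λ x → when (Vec.≡-dec ℕ._≟_ (flagComposition X) (a x)) (g x)))) ∎

  sum-compositions-ν : ∀ (M : Matroid n) (g : Vec ℕ (suc r) → Carrier) →
    sum (compositions n r) (λ a → fromℕ (ν M a) *ᴿ g a)
      ≈ sum (words (subsets n) (suc r)) (λ X → when (isFlag? M X) (g (flagComposition X)))
  sum-compositions-ν {n} {r} M g = R.trans (sum-ν M (compositions n r) id g)
    (sum-cong (words (subsets n) (suc r)) λ X → when-congʳ (isFlag? M X) λ isFlag → R.trans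
      (sum-single (compositions-unique n r) (∈-compositions (flagComposition-isComposition M X isFlag)) λ a a≢ →
        when-no (Vec.≡-dec ℕ._≟_ (flagComposition X) a) (a≢ ∘ sym))
      (when-yes (Vec.≡-dec ℕ._≟_ (flagComposition X) (flagComposition X)) refl))

  module _ (fractions : Fractions R) where
    open Fractions fractions
    open FlagSums R fractions

    -- A splitting can match the composition of a flag only if merging its last two parts gives
    -- `a ∷ʳ a′`, and then `(x , y)` is the only one that does.
    sum-splittings : ∀ (a : Vec ℕ m) a′ b {x y} → 0 < x → 0 < y →
      sum (splittings a′) (λ p → when (Vec.≡-dec ℕ._≟_ (b ∷ʳ x ∷ʳ y) (a ∷ʳ proj₁ p ∷ʳ proj₂ p)) (fraction (proj₁ p) (proj₁ p + proj₂ p)))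
        ≈ fraction x (x + y) *ᴿ when (Vec.≡-dec ℕ._≟_ (b ∷ʳ (x + y)) (a ∷ʳ a′)) 1#
    sum-splittings a a′ b {x} {y} 0<x 0<y with Vec.≡-dec ℕ._≟_ (b ∷ʳ (x + y)) (a ∷ʳ a′)
    ... | yes eq with Vec.∷ʳ-injective b a eq
    ... | refl , refl = R.trans
            (sum-single (splittings-unique a′) (∈-splittings (0<x , 0<y , refl)) λ (u , v) ≢ →
              when-no (Vec.≡-dec ℕ._≟_ (b ∷ʳ x ∷ʳ y) (a ∷ʳ u ∷ʳ v)) λ eq →
                ≢ (cong₂ _,_ (sym (proj₂ (Vec.∷ʳ-injective b a (Vec.∷ʳ-injectiveˡ (b ∷ʳ x) (a ∷ʳ u) eq))))
                             (sym (Vec.∷ʳ-injectiveʳ (b ∷ʳ x) (a ∷ʳ u) eq))))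
            (R.trans (when-yes (Vec.≡-dec ℕ._≟_ (b ∷ʳ x ∷ʳ y) (a ∷ʳ x ∷ʳ y)) refl) (R.sym (R.*-identityʳ _)))
    sum-splittings a a′ b {x} {y} 0<x 0<y | no ≢ = R.trans (R.trans
      (sum-filter (isSplitting? a′) (List.cartesianProduct (upTo (suc a′)) (upTo (suc a′))))
      (sum-0 (List.cartesianProduct (upTo (suc a′)) (upTo (suc a′))) λ (u , v) → R.trans
        (when-congʳ (isSplitting? a′ (u , v)) λ (_ , _ , u+v≡) →
          when-no (Vec.≡-dec ℕ._≟_ (b ∷ʳ x ∷ʳ y) (a ∷ʳ u ∷ʳ v)) λ eq →
            ≢ (trans (sym (mergeLast-∷ʳ b x y)) (trans (cong mergeLast eq) (trans (mergeLast-∷ʳ a u v) (cong (a ∷ʳ_) u+v≡)))))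
        (when-0 (isSplitting? a′ (u , v)))))
      (R.sym (R.zeroʳ _))

    ν-Trun : ∀ (M : Matroid n) (pos : 0 < Matroid.rank M) → Matroid.rank M ≡ 2 + k → (a : Vec ℕ (suc k)) (a′ : ℕ) →
      fromℕ (ν (Trun M pos) (a ∷ʳ a′))
        ≈ sum (splittings a′) (λ p → fromℕ (ν M (a ∷ʳ proj₁ p ∷ʳ proj₂ p)) *ᴿ fraction (proj₁ p) (proj₁ p + proj₂ p))
    ν-Trun {n} {k} M pos rank≡ a a′ = begin
      fromℕ (ν (Trun M pos) (a ∷ʳ a′))
        ≈⟨ fromℕ-length-filter (λ X → isFlag? (Trun M pos) X ×-dec Vec.≡-dec ℕ._≟_ (flagComposition X) (a ∷ʳ a′)) (words (subsets n) (2 + k)) ⟩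
      sum (words (subsets n) (2 + k)) (λ X → when (isFlag? (Trun M pos) X ×-dec Vec.≡-dec ℕ._≟_ (flagComposition X) (a ∷ʳ a′)) 1#)
        ≈⟨ sum-cong (words (subsets n) (2 + k)) (λ X → when-× (isFlag? (Trun M pos) X) (Vec.≡-dec ℕ._≟_ (flagComposition X) (a ∷ʳ a′))) ⟩
      sum (words (subsets n) (2 + k)) (λ X → when (isFlag? (Trun M pos) X) (indicator (flagComposition X)))
        ≈⟨ sum-flags-Trun M pos rank≡ indicator ⟨
      sum (words (subsets n) (3 + k)) (λ X → when (isFlag? M X) (lastFraction (flagComposition X) *ᴿ indicator (mergeLast (flagComposition X))))
        ≈⟨ sum-cong (words (subsets n) (3 + k)) (λ X → when-congʳ (isFlag? M X) λ isFlag →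
             by-composition (flagComposition X) (splitLastTwo (flagComposition X)) (proj₁ (flagComposition-isComposition M X isFlag))) ⟩
      sum (words (subsets n) (3 + k)) (λ X → when (isFlag? M X) (sum (splittings a′) (λ p →
        when (Vec.≡-dec ℕ._≟_ (flagComposition X) (a ∷ʳ proj₁ p ∷ʳ proj₂ p)) (fraction (proj₁ p) (proj₁ p + proj₂ p)))))
        ≈⟨ sum-ν M (splittings a′) (λ p → a ∷ʳ proj₁ p ∷ʳ proj₂ p) (λ p → fraction (proj₁ p) (proj₁ p + proj₂ p)) ⟨
      sum (splittings a′) (λ p → fromℕ (ν M (a ∷ʳ proj₁ p ∷ʳ proj₂ p)) *ᴿ fraction (proj₁ p) (proj₁ p + proj₂ p)) ∎
      where
      indicator : Vec ℕ (2 + k) → Carrier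
      indicator v = when (Vec.≡-dec ℕ._≟_ v (a ∷ʳ a′)) 1#

      by-composition : (v : Vec ℕ (3 + k)) → ∃[ b ] ∃[ x ] ∃[ y ] v ≡ b ∷ʳ x ∷ʳ y → VecAll.All (0 <_) (tail v) →
        lastFraction v *ᴿ indicator (mergeLast v)
          ≈ sum (splittings a′) (λ p → when (Vec.≡-dec ℕ._≟_ v (a ∷ʳ proj₁ p ∷ʳ proj₂ p)) (fraction (proj₁ p) (proj₁ p + proj₂ p)))
      -- Positivity is known for all parts but the first. Taking `b₀` off shows that `x` and `y` are
      -- among them, so that they form a splitting.
      by-composition v (b₀ ∷ b , x , y , refl) v>0 = R.trans
        (R.*-cong
          (R.reflexive (cong₂ (λ u w → fraction u (u + w))
            (trans (cong last (Vec.init-∷ʳ y ((b₀ ∷ b) ∷ʳ x))) (Vec.last-∷ʳ x (b₀ ∷ b))) (Vec.last-∷ʳ y ((b₀ ∷ b) ∷ʳ x))))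
          (R.reflexive (cong indicator (mergeLast-∷ʳ (b₀ ∷ b) x y))))
        (R.sym (sum-splittings a a′ (b₀ ∷ b) (proj₂ (All-∷ʳ⁻ b (proj₁ (All-∷ʳ⁻ (b ∷ʳ x) v>0)))) (proj₂ (All-∷ʳ⁻ (b ∷ʳ x) v>0))))

-- The invariant over the field, symbol by symbol

module FromNat {c ℓ} (R : CommutativeSemiring c ℓ) where
  private module R = CommutativeSemiring R
  open Sum R
  private module ℕ-Sum = Sum ℕ.+-*-commutativeSemiring

  fromℕ-1 : fromℕ 1 R.≈ R.1#
  fromℕ-1 = R.+-identityʳ R.1#

  fromℕ-when : (φ? : Dec Φ) {k : ℕ} → fromℕ (ℕ-Sum.when φ? k) R.≈ when φ? (fromℕ k)
  fromℕ-when (yes _) = R.refl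
  fromℕ-when (no _)  = R.refl

  fromℕ-sum : (xs : List A) {f : A → ℕ} → fromℕ (ℕ-Sum.sum xs f) R.≈ sum xs (fromℕ ∘ f)
  fromℕ-sum []           = R.refl
  fromℕ-sum (x ∷ xs) {f} = R.trans (fromℕ-+ (f x) _) (R.+-congˡ (fromℕ-sum xs))

symbolComposition : (s : Symbol n r) → ∃[ b ] (IsComposition n r b × word b ≡ Symbol.entries s)
symbolComposition record { binary = binary ; size = refl ; ones = refl } with word-surjective binary
... | b , b>0 , sum≡ , word≡ = b , (b>0 , sum≡) , word≡

module Field {c ℓ₁ ℓ₂} (K : HeytingField c ℓ₁ ℓ₂) where
  private
    module K = HeytingField K
    ring : CommutativeRing c ℓ₁
    ring = HeytingCommutativeRing.commutativeRing K.heytingCommutativeRing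
    semiring : CommutativeSemiring c ℓ₁
    semiring = CommutativeRing.commutativeSemiring ring
    module R = CommutativeSemiring semiring
    module ℕ-Sum = Sum ℕ.+-*-commutativeSemiring
  open 𝒢-Space K using (CharacteristicZero; ratioᴷ; 𝒢-invariant; γ)
  open Sum semiring
  open FromNat semiring
  open FlagCounts semiring
  open import Relation.Binary.Reasoning.Setoid R.setoid

  fractions : CharacteristicZero → Fractions semiring
  fractions char0 = record
    { fraction     = ratioᴷ char0
    ; 1/suc        = λ b → proj₁ (K.#⇒invertible (char0 b))
    ; fraction-suc = λ _ _ → R.refl
    -- The inverse belongs to the difference with 0, which is first simplified.
    ; inverseʳ     = λ b → R.trans (R.*-congʳ (R.sym (R.trans (R.+-congˡ -0#≈0#) (R.+-identityʳ _))))
                             (proj₂ (proj₂ (K.#⇒invertible (char0 b))))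
    }
    where open RingProperties (CommutativeRing.ring ring) using (-0#≈0#)

  γ-entry : (s : Symbol n r) {a b : Vec ℕ (suc r)} → VecAll.All (0 <_) (tail a) →
    IsComposition n r b → word b ≡ Symbol.entries s → γ a s R.≈ fromℕ (γ-coeff a b)
  γ-entry {n} {r} s {a} {b} a>0 comp word≡ = begin
    γ a s
      ≈⟨ sum-filter (_⊵? a) (compositions n r) ⟩
    sum (compositions n r) (λ b′ → when (b′ ⊵? a) (fromℕ (γ-coeff a b′) R.* entry b′))
      ≈⟨ sum-cong (compositions n r) (λ b′ → dominance b′ (b′ ⊵? a)) ⟩
    sum (compositions n r) (λ b′ → fromℕ (γ-coeff a b′) R.* entry b′)
      -- Membership in the list is reopened as a condition, because `word-injective` needs the
      -- positivity that it provides.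
      ≈⟨ sum-filter (isComposition? n r) (words (upTo (suc n)) (suc r)) ⟩
    sum (words (upTo (suc n)) (suc r)) (λ b′ → when (isComposition? n r b′) (fromℕ (γ-coeff a b′) R.* entry b′))
      ≈⟨ sum-single {y = b} (words-unique (Unique.upTo⁺ (suc n)) (suc r)) (proj₁ (∈-filter⁻ (isComposition? n r) (∈-compositions {a = b} comp)))
           (λ b′ b′≢b → R.trans
             (when-congʳ (isComposition? n r b′) λ comp′ → R.trans
               (R.*-congˡ (when-no (List.≡-dec ℕ._≟_ (word b′) (Symbol.entries s))
                 λ eq → b′≢b (word-injective {b = b′} {b} (proj₁ comp′) (proj₁ comp) (trans eq (sym word≡)))))
               (R.zeroʳ _))
             (when-0 (isComposition? n r b′))) ⟩
    when (isComposition? n r b) (fromℕ (γ-coeff a b) R.* entry b)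
      ≈⟨ when-yes (isComposition? n r b) comp ⟩
    fromℕ (γ-coeff a b) R.* entry b
      ≈⟨ R.*-congˡ (when-yes (List.≡-dec ℕ._≟_ (word b) (Symbol.entries s)) word≡) ⟩
    fromℕ (γ-coeff a b) R.* R.1#
      ≈⟨ R.*-identityʳ _ ⟩
    fromℕ (γ-coeff a b) ∎
    where
    entry : Vec ℕ (suc r) → R.Carrier
    entry b′ = when (List.≡-dec ℕ._≟_ (word b′) (Symbol.entries s)) R.1#
    dominance : ∀ b′ (d? : Dec (b′ ⊵ a)) → when d? (fromℕ (γ-coeff a b′) R.* entry b′) R.≈ fromℕ (γ-coeff a b′) R.* entry b′
    dominance b′ (yes _)  = R.refl
    dominance b′ (no ¬⊵) = R.sym (R.trans (R.*-congʳ (R.reflexive (cong fromℕ (γ-coeff-⋬ {a = a} {b′} a>0 ¬⊵)))) (R.zeroˡ _))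

  -- Each symbol is the word of some composition `b`, and the two coordinates there are the images
  -- in the field of the two natural numbers equated by `count-orderings-word`.
  𝒢-invariant-flags : (N : Matroid n) → r ≡ Matroid.rank N → (s : Symbol n r) →
    𝒢-invariant r N s R.≈ sum (words (subsets n) (suc r)) (λ X → when (isFlag? N X) (γ (flagComposition X) s))
  𝒢-invariant-flags {n} {r} N r≡ s = go (symbolComposition s)
    where
    go : ∃[ b ] (IsComposition n r b × word b ≡ Symbol.entries s) →
      𝒢-invariant r N s R.≈ sum (words (subsets n) (suc r)) (λ X → when (isFlag? N X) (γ (flagComposition X) s))
    go (b , comp , word≡) = begin
      sum (orderings n) (λ π → when (List.≡-dec ℕ._≟_ (rankSequence N π) (Symbol.entries s)) R.1#)
        ≈⟨ sum-cong (orderings n) (λ π → R.trans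
             (when-cong (List.≡-dec ℕ._≟_ (rankSequence N π) (Symbol.entries s)) (List.≡-dec ℕ._≟_ (rankSequence N π) (word b))
               (λ eq → trans eq (sym word≡)) (λ eq → trans eq word≡) λ _ → R.sym fromℕ-1)
             (R.sym (fromℕ-when (List.≡-dec ℕ._≟_ (rankSequence N π) (word b))))) ⟩
      sum (orderings n) (λ π → fromℕ (ℕ-Sum.when (List.≡-dec ℕ._≟_ (rankSequence N π) (word b)) 1))
        ≈⟨ fromℕ-sum (orderings n) ⟨
      fromℕ (ℕ-Sum.sum (orderings n) (λ π → ℕ-Sum.when (List.≡-dec ℕ._≟_ (rankSequence N π) (word b)) 1))
        ≈⟨ R.reflexive (cong fromℕ (OrderingsAlongFlags.count-orderings-word N b comp r≡ (trans (cong length word≡) (Symbol.size s)))) ⟩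
      fromℕ (ℕ-Sum.sum (words (subsets n) (suc r)) (λ X → ℕ-Sum.when (isFlag? N X) (γ-coeff (flagComposition X) b)))
        ≈⟨ fromℕ-sum (words (subsets n) (suc r)) ⟩
      sum (words (subsets n) (suc r)) (λ X → fromℕ (ℕ-Sum.when (isFlag? N X) (γ-coeff (flagComposition X) b)))
        ≈⟨ sum-cong (words (subsets n) (suc r)) (λ X → R.trans (fromℕ-when (isFlag? N X))
             (when-congʳ (isFlag? N X) λ isFlag →
               R.sym (γ-entry s {flagComposition X} {b} (proj₁ (flagComposition-isComposition N X isFlag)) comp word≡))) ⟩
      sum (words (subsets n) (suc r)) (λ X → when (isFlag? N X) (γ (flagComposition X) s)) ∎

  𝒢-invariant-Trun : (char0 : CharacteristicZero) (M : Matroid n) (pos : 0 < Matroid.rank M) → Matroid.rank M ≡ 2 + k →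
    ∀ s → 𝒢-invariant (1 + k) (Trun M pos) s
      R.≈ sum (compositions n (2 + k)) (λ a →
            (fromℕ (ν M a) R.* ratioᴷ char0 (last (init a)) (last (init a) + last a)) R.* γ (mergeLast a) s)
  𝒢-invariant-Trun {n} {k} char0 M pos rank≡ s = begin
    𝒢-invariant (1 + k) (Trun M pos) s
      ≈⟨ 𝒢-invariant-flags (Trun M pos) (sym (Truncation.rank-Trun M pos rank≡)) s ⟩
    sum (words (subsets n) (2 + k)) (λ X → when (isFlag? (Trun M pos) X) (γ (flagComposition X) s))
      ≈⟨ sum-flags-Trun M pos rank≡ (λ c → γ c s) ⟨
    sum (words (subsets n) (3 + k)) (λ X → when (isFlag? M X)
        (lastFraction (flagComposition X) R.* γ (mergeLast (flagComposition X)) s))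
      ≈⟨ sum-compositions-ν M (λ a → lastFraction a R.* γ (mergeLast a) s) ⟨
    sum (compositions n (2 + k)) (λ a → fromℕ (ν M a) R.* (lastFraction a R.* γ (mergeLast a) s))
      ≈⟨ sum-cong (compositions n (2 + k)) (λ a → R.sym (R.*-assoc (fromℕ (ν M a)) (lastFraction a) (γ (mergeLast a) s))) ⟩
    sum (compositions n (2 + k)) (λ a → (fromℕ (ν M a) R.* lastFraction a) R.* γ (mergeLast a) s) ∎
    where open FlagSums semiring (fractions char0)

-- Rational fractions

ℚ-semiring : CommutativeSemiring _ _
ℚ-semiring = CommutativeRing.commutativeSemiring ℚ.+-*-commutativeRing

-- Since `ℚ._/_` divides by the gcd, this equation and the next ones on `ratio` are checked on
-- unnormalised fractions, as integer identities after cross-multiplication.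
ℕ→ℚ-suc : ∀ m → ℕ→ℚ (suc m) ≡ ℚ.1ℚ ℚ.+ ℕ→ℚ m
ℕ→ℚ-suc m = ℚ.toℚᵘ-injective (ℚᵘ.≃-trans (ℚ.toℚᵘ-fromℚᵘ (ℚᵘ.mkℚᵘ (ℤ.+ suc m) 0))
  (ℚᵘ.≃-trans (ℚᵘ.*≡* (cong (λ t → (ℤ.+ 1 ℤ.+ t) ℤ.* ℤ.+ 1) (sym (ℤ.*-identityʳ (ℤ.+ m)))))
    (ℚᵘ.≃-sym (ℚᵘ.≃-trans (ℚ.toℚᵘ-homo-+ ℚ.1ℚ (ℕ→ℚ m))
      (ℚᵘ.+-congʳ ℚᵘ.1ℚᵘ (ℚ.toℚᵘ-fromℚᵘ (ℚᵘ.mkℚᵘ (ℤ.+ m) 0)))))))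

fromℕ≡ℕ→ℚ : ∀ m → Sum.fromℕ ℚ-semiring m ≡ ℕ→ℚ m
fromℕ≡ℕ→ℚ zero    = refl
fromℕ≡ℕ→ℚ (suc m) = trans (cong (ℚ.1ℚ ℚ.+_) (fromℕ≡ℕ→ℚ m)) (sym (ℕ→ℚ-suc m))

ratio-suc : ∀ x b → ratio x (suc b) ≡ ℕ→ℚ x ℚ.* (ℤ.+ 1 ℚ./ suc b)
ratio-suc x b = ℚ.toℚᵘ-injective (ℚᵘ.≃-trans (ℚ.toℚᵘ-fromℚᵘ (ℚᵘ.mkℚᵘ (ℤ.+ x) b))
  (ℚᵘ.≃-trans (ℚᵘ.*≡* (cong₂ ℤ._*_ (sym (ℤ.*-identityʳ (ℤ.+ x))) (cong (λ t → ℤ.+ suc t) (ℕ.+-identityʳ b))))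
    (ℚᵘ.≃-sym (ℚᵘ.≃-trans (ℚ.toℚᵘ-homo-* (ℕ→ℚ x) (ℤ.+ 1 ℚ./ suc b))
      (ℚᵘ.*-cong (ℚ.toℚᵘ-fromℚᵘ (ℚᵘ.mkℚᵘ (ℤ.+ x) 0)) (ℚ.toℚᵘ-fromℚᵘ (ℚᵘ.mkℚᵘ (ℤ.+ 1) b)))))))

ratio-self : ∀ b → ratio (suc b) (suc b) ≡ ℚ.1ℚ
ratio-self b = ℚ.toℚᵘ-injective (ℚᵘ.≃-trans (ℚ.toℚᵘ-fromℚᵘ (ℚᵘ.mkℚᵘ (ℤ.+ suc b) b))
  (ℚᵘ.*≡* (ℤ.*-comm (ℤ.+ suc b) (ℤ.+ 1))))

ℚ-fractions : Fractions ℚ-semiring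
ℚ-fractions = record
  { fraction     = ratio
  ; 1/suc        = λ b → ℤ.+ 1 ℚ./ suc b
  ; fraction-suc = λ x b → trans (ratio-suc x b) (cong (ℚ._* (ℤ.+ 1 ℚ./ suc b)) (sym (fromℕ≡ℕ→ℚ x)))
  ; inverseʳ     = λ b → trans (cong (ℚ._* (ℤ.+ 1 ℚ./ suc b)) (fromℕ≡ℕ→ℚ (suc b)))
                           (trans (sym (ratio-suc (suc b) b)) (ratio-self b))
  }

proposition9p1 : ∀ {c ℓ₁ ℓ₂} (K : HeytingField c ℓ₁ ℓ₂) →
    let open 𝒢-Space K
        module K = HeytingField K in
    (char0 : CharacteristicZero) →
    ∀ {n k} (M : Matroid n) (pos : 0 < Matroid.rank M) → Matroid.rank M ≡ 2 + k →
    (∀ (a : Vec ℕ (suc k)) (a′ : ℕ) → IsComposition n (suc k) (a ∷ʳ a′) →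
       ℕ→ℚ (ν (Trun M pos) (a ∷ʳ a′))
         ≡ sumℚ (splittings a′) λ (x , y) → ℕ→ℚ (ν M (a ∷ʳ x ∷ʳ y)) ℚ.* ratio x (x + y))
    ×
    (𝒢-invariant (1 + k) (Trun M pos)
       ≋ ∑ (compositions n (2 + k)) λ a →
           let a₋ = init (init a)
               x  = last (init a)
               y  = last a
           in (fromℕ (ν M a) K.* ratioᴷ char0 x (x + y)) · γ (a₋ ∷ʳ (x + y)))
proposition9p1 K char0 M pos rank≡ =
    -- `ν-Trun` embeds counts by repeated addition of 1, and `fromℕ≡ℕ→ℚ` passes to the embedding
    -- through the integers.
    (λ a a′ _ → trans (sym (fromℕ≡ℕ→ℚ (ν (Trun M pos) (a ∷ʳ a′))))
      (trans (FlagCounts.ν-Trun ℚ-semiring ℚ-fractions M pos rank≡ a a′)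
        (Sum.sum-cong ℚ-semiring (splittings a′) λ (x , y) → cong (ℚ._* ratio x (x + y)) (fromℕ≡ℕ→ℚ (ν M (a ∷ʳ x ∷ʳ y))))))
  , Field.𝒢-invariant-Trun K char0 M pos rank≡
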